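{- Let $G$ be a finite simple cubic graph. Then $Z(G)=3$ if and only if $G$ is isomorphic to one of the following: (i) $K_1\blacktriangle T_m$ for some integer $m\geq 0$; or (ii) a member of the family $K_1\blacktriangle G_1\uplus\cdots\uplus G_t\uplus T_m$ for some integers $t\geq 1$, $m\geq 0$, where each $G_i$ is a copy of $M_{n_i}$ for some integer $n_i\geq 0$.
   Context: Zero forcing: each vertex is coloured black or white; if a black vertex has exactly one white neighbour, that neighbour becomes black. $Z\subseteq V(G)$ is a zero forcing set if starting from $Z$ black and repeating this rule, all vertices become black; $Z(G)$ is the minimum size of a zero forcing set. For $n\geq 0$, $M_n$ is the graph with vertices $x_0,\dots,x_n,y_0,\dots,y_n,z_1,z_2$ and edges $x_{i-1}x_i$, $y_{i-1}y_i$ ($1\le i\le n$), $x_iy_i$ ($0\le i\le n$), $x_nz_1$, $z_1z_2$ (so $M_0$ is the path $y_0x_0z_1z_2$). Its in-vertices are $x_0,y_0,z_2$ and its out-vertices are $y_n,z_1,z_2$. For $m\geq 0$, $T_m$ is the graph with vertices $p_0,\dots,p_m,q_0,\dots,q_m,r$ and edges $p_{i-1}p_i$, $q_{i-1}q_i$ ($1\le i\le m$), $p_iq_i$ ($0\le i\le m$), $p_mr$, $q_mr$ (so $T_0\cong K_3$). Its in-vertices are $p_0,q_0,r$. $K_1\blacktriangle T_m$ is obtained from $T_m$ by adding a new vertex $u$ adjacent to $p_0,q_0,r$ (so $K_1\blacktriangle T_0\cong K_4$). The family $K_1\blacktriangle G_1\uplus\cdots\uplus G_t\uplus T_m$ (with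 $G_i$ a copy of $M_{n_i}$) consists of all graphs obtained as follows: take the disjoint union of a new vertex $u$, $G_1,\dots,G_t$ and $T_m$; join $u$ to the three in-vertices of $G_1$; and for each $1\le i\le t$, writing $G_{t+1}:=T_m$, add three edges forming an arbitrary bijection between the three out-vertices of $G_i$ and the three in-vertices of $G_{i+1}$. -}

module Defs where

open import Data.Nat using (ℕ; zero; suc; _≤_)
open import Data.Bool using (Bool; true; false; if_then_else_)
open import Data.Fin using (Fin; zero; suc; toℕ; fromℕ; inject₁)
open import Data.Fin.Subset using (Subset; _∈_; ∣_∣)
open import Data.Fin.Permutation using (Permutation′; _⟨$⟩ʳ_)
open import Data.List using (List; map; allFin)
open import Data.Nat.ListAction using (sum)
open import Data.Product using (Σ; _×_; _,_)
open import Data.Sum using (_⊎_)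
open import Function.Bundles using (_↔_; _⇔_; Inverse)
open import Relation.Binary.PropositionalEquality using (_≡_; _≢_)

record Graph : Set where
  field
    order  : ℕ
    adj    : Fin order → Fin order → Bool
    adj-sym    : ∀ i j → adj i j ≡ adj j i
    adj-irrefl : ∀ i → adj i i ≡ false
open Graph public

degree : (G : Graph) → Fin (order G) → ℕ
degree G v = sum (map (λ w → if adj G v w then 1 else 0) (allFin (order G)))

Cubic : Graph → Set
Cubic G = ∀ v → degree G v ≡ 3

-- Zero forcing.  Black G Z v: v is black in the final colouring obtained
-- from the initial black set Z by repeatedly applying the colour-change
-- rule (a black vertex u all of whose neighbours other than v are black,
-- i.e. whose only white neighbour is v, forces v).

data Black (G : Graph) (Z : Subset (order G)) : Fin (order G) → Set where
  initial : ∀ {v} → v ∈ Z → Black G Z v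
  force   : ∀ {u v} → Black G Z u → adj G u v ≡ true →
            (∀ w → adj G u w ≡ true → w ≢ v → Black G Z w) →
            Black G Z v

IsZeroForcingSet : (G : Graph) → Subset (order G) → Set
IsZeroForcingSet G Z = ∀ v → Black G Z v

ZeroForcingNumber : Graph → ℕ → Set
ZeroForcingNumber G k =
  Σ (Subset (order G)) (λ Z → IsZeroForcingSet G Z × ∣ Z ∣ ≡ k)
  × (∀ Z → IsZeroForcingSet G Z → k ≤ ∣ Z ∣)

IsoTo : (G : Graph) (V : Set) (Adj : V → V → Set) → Set
IsoTo G V Adj =
  Σ (Fin (order G) ↔ V) λ f →
    ∀ i j → (adj G i j ≡ true) ⇔ Adj (Inverse.to f i) (Inverse.to f j)

-- The family K₁ ▲ G₁ ⊎ ... ⊎ G_t ⊎ T_m.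
-- Parameters: t, ns i = n_i (G_i is a copy of M_{n_i}), m, and
-- σ i : bijection from the out-vertices of G_i to the in-vertices of
-- G_{i+1} (G_{t+1} = T_m).
-- In-vertices of M_n are numbered 0 ↦ x₀, 1 ↦ y₀, 2 ↦ z₂;
-- out-vertices of M_n:              0 ↦ y_n, 1 ↦ z₁, 2 ↦ z₂;
-- in-vertices of T_m:               0 ↦ p₀, 1 ↦ q₀, 2 ↦ r.
-- For t = 0 this is exactly K₁ ▲ T_m.

module Family (t : ℕ) (ns : Fin t → ℕ) (m : ℕ) (σ : Fin t → Permutation′ 3) where

  data V : Set where
    u       : V
    x y     : (i : Fin t) → Fin (suc (ns i)) → V
    z₁ z₂   : Fin t → V
    p q     : Fin (suc m) → V
    r       : V

  inM : Fin t → Fin 3 → V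
  inM i zero             = x i zero
  inM i (suc zero)       = y i zero
  inM i (suc (suc zero)) = z₂ i

  outM : Fin t → Fin 3 → V
  outM i zero             = y i (fromℕ (ns i))
  outM i (suc zero)       = z₁ i
  outM i (suc (suc zero)) = z₂ i

  inT : Fin 3 → V
  inT zero             = p zero
  inT (suc zero)       = q zero
  inT (suc (suc zero)) = r

  data Arc : V → V → Set where
    xx  : ∀ i (j : Fin (ns i)) → Arc (x i (inject₁ j)) (x i (suc j))
    yy  : ∀ i (j : Fin (ns i)) → Arc (y i (inject₁ j)) (y i (suc j))
    xy  : ∀ i (j : Fin (suc (ns i))) → Arc (x i j) (y i j)
    xz  : ∀ i → Arc (x i (fromℕ (ns i))) (z₁ i)
    zz  : ∀ i → Arc (z₁ i) (z₂ i)
    pp  : ∀ (j : Fin m) → Arc (p (inject₁ j)) (p (suc j))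
    qq  : ∀ (j : Fin m) → Arc (q (inject₁ j)) (q (suc j))
    pq  : ∀ (j : Fin (suc m)) → Arc (p j) (q j)
    pr  : Arc (p (fromℕ m)) r
    qr  : Arc (q (fromℕ m)) r
    uM  : ∀ (i : Fin t) → toℕ i ≡ 0 → ∀ k → Arc u (inM i k)
    uT  : t ≡ 0 → ∀ k → Arc u (inT k)
    chainM : ∀ (i j : Fin t) → toℕ j ≡ suc (toℕ i) → ∀ k →
             Arc (outM i k) (inM j (σ i ⟨$⟩ʳ k))
    chainT : ∀ (i : Fin t) → suc (toℕ i) ≡ t → ∀ k →
             Arc (outM i k) (inT (σ i ⟨$⟩ʳ k))

  Adj : V → V → Set
  Adj a b = Arc a b ⊎ Arc b a

IsoFamily : Graph → (t : ℕ) → (Fin t → ℕ) → ℕ → (Fin t → Permutation′ 3) → Set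
IsoFamily G t ns m σ = IsoTo G (Family.V t ns m σ) (Family.Adj t ns m σ)

IsoK1T : Graph → ℕ → Set
IsoK1T G m = IsoFamily G 0 (λ ()) m (λ ())

{-# OPTIONS --safe #-}
-- Let three vertices force a cubic graph.  The first force blackens a vertex u and its neighbours, so
-- it remains to follow the three edges leaving {u}.  Whenever exactly three edges h k — i k leave a
-- black set, forcing can only be completed if the i k all coincide, or are distinct with two of them
-- adjacent: a set left by exactly two edges (as arises when just two of the i k coincide), or by three
-- edges to distinct pairwise nonadjacent vertices, leads to a black set all of whose vertices have
-- zero or at least two white neighbours.
-- Hence the graph arises from u by adding rungs between two of three growing paths, and finally a
-- vertex r joined to the three ends.  A maximal run of rungs between the same two paths, together
-- with the next rung, is a copy of M_n.  The last rung and r span a triangle, so this rung may be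
-- reassigned to any two paths, and a last rung following a run can be taken to continue it; thus
-- the last block can always be read as T_m.
-- Conversely, in such a graph every vertex other than u and two of its neighbours is forced by its
-- predecessor, and three is always a lower bound: the first forcing vertex and two of its neighbours
-- are in Z.
module Submission where

open import Defs
open import Data.Bool using (Bool; true; false; if_then_else_)
import Data.Bool.Properties as Bool
open import Data.Empty using (⊥; ⊥-elim)
open import Data.Fin using (Fin; zero; suc; fromℕ; inject₁; toℕ; fromℕ<)
open import Data.Fin.Patterns using (0F; 1F; 2F)
open import Data.Fin.Permutation as Perm
  using (Permutation′; transpose; _⟨$⟩ʳ_; _⟨$⟩ˡ_; inverseˡ; inverseʳ; _∘ₚ_)
open import Data.Fin.Properties
  using (_≟_; any?; suc-injective; toℕ-fromℕ; toℕ-inject₁; toℕ-fromℕ<; toℕ<n; toℕ-injective; ¬Fin0)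
open import Data.Fin.Relation.Unary.Top using (view; ‵fromℕ; ‵inject₁)
open import Data.Fin.Subset as Subset using (Subset; ∣_∣; ⁅_⁆; _∪_; ⊤)
open import Data.Fin.Subset.Properties
  using (p⊆q⇒∣p∣≤∣q∣; x∈p⇒∣p-x∣<∣p∣; x∈p∧x≢y⇒x∈p-y; x∈⁅x⁆; ∣⁅x⁆∣≡1; x∈p∪q⁺; ∣⊥∣≡0; ∈⊤; ∣p∣≤n)
  renaming (_∈?_ to _∈ˢ?_)
open import Data.List as List using (List; []; _∷_; _++_; length; foldr)
import Data.List.Membership.DecPropositional as DecMembership
open import Data.List.Membership.Propositional using (_∈_; _∉_)
open import Data.List.Membership.Propositional.Properties
  using (∈-++⁺ˡ; ∈-++⁺ʳ; ∈-++⁻; ∈-tabulate⁺; ∈-tabulate⁻)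
import Data.List.Properties as List
open import Data.List.Relation.Unary.All as All using (All; []; _∷_)
import Data.List.Relation.Unary.All.Properties as All
open import Data.List.Relation.Unary.AllPairs using ([]; _∷_)
open import Data.List.Relation.Unary.Any using (here; there)
open import Data.List.Relation.Unary.Unique.Propositional using (Unique)
open import Data.Nat using (ℕ; zero; suc; _+_; _≤_; _<_; _≥_; z≤n; s≤s; _<?_)
open import Data.Nat.Induction using (<-wellFounded)
open import Data.Nat.ListAction using (sum)
import Data.Nat.Properties as ℕ
open import Data.Product using (Σ; ∃-syntax; ∃₂; _×_; _,_; proj₁; proj₂)
open import Data.Product.Relation.Binary.Lex.Strict
  using (×-Lex; ×-wellFounded; ×-transitive; ×-irreflexive)
open import Data.Sum as Sum using (_⊎_; inj₁; inj₂; [_,_]′)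
import Data.Vec as Vec
import Data.Vec.Functional as F
import Data.Vec.Properties as Vec
open import Function using (_∘_; id; _on_)
open import Function.Bundles using (_⇔_; Inverse; Equivalence; mk↔ₛ′; mk⇔)
open import Induction.WellFounded using (WellFounded; Acc; acc)
import Relation.Binary.Construct.On as On
open import Relation.Binary.PropositionalEquality
open import Relation.Nullary using (Dec; yes; no; ¬_; contradiction)
open import Relation.Nullary.Decidable using (_×-dec_; ¬?; decidable-stable)

private variable n : ℕ

-- Counting with finite subsets and duplicate-free lists

_∈?_ : (x : Fin n) (xs : List (Fin n)) → Dec (x ∈ xs)
_∈?_ = DecMembership._∈?_ _≟_

_∈ˢ_ : Fin n → Subset n → Set
_∈ˢ_ = Subset._∈_

length≤∣p∣ : (xs : List (Fin n)) {p : Subset n} →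
             Unique xs → All (_∈ˢ p) xs → length xs ≤ ∣ p ∣
length≤∣p∣ []       _           _          = z≤n
length≤∣p∣ (x ∷ xs) (x≢ ∷ uniq) (x∈p ∷ xs∈p) =
  ℕ.≤-trans (s≤s (length≤∣p∣ xs uniq
    (All.zipWith (λ (≢ , ∈p) → x∈p∧x≢y⇒x∈p-y ∈p (≢ ∘ sym)) (x≢ , xs∈p))))
            (x∈p⇒∣p-x∣<∣p∣ x∈p)

∣p∪q∣≤∣p∣+∣q∣ : (p q : Subset n) → ∣ p ∪ q ∣ ≤ ∣ p ∣ + ∣ q ∣
∣p∪q∣≤∣p∣+∣q∣ Vec.[]            Vec.[]            = z≤n
∣p∪q∣≤∣p∣+∣q∣ (true Vec.∷ p)  (true Vec.∷ q)  =
  s≤s (ℕ.≤-trans (∣p∪q∣≤∣p∣+∣q∣ p q) (ℕ.+-monoʳ-≤ ∣ p ∣ (ℕ.n≤1+n _)))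
∣p∪q∣≤∣p∣+∣q∣ (true Vec.∷ p)  (false Vec.∷ q) = s≤s (∣p∪q∣≤∣p∣+∣q∣ p q)
∣p∪q∣≤∣p∣+∣q∣ (false Vec.∷ p) (true Vec.∷ q)  =
  ℕ.≤-trans (s≤s (∣p∪q∣≤∣p∣+∣q∣ p q)) (ℕ.≤-reflexive (sym (ℕ.+-suc ∣ p ∣ ∣ q ∣)))
∣p∪q∣≤∣p∣+∣q∣ (false Vec.∷ p) (false Vec.∷ q) = ∣p∪q∣≤∣p∣+∣q∣ p q

ofList : List (Fin n) → Subset n
ofList = foldr (λ x p → ⁅ x ⁆ ∪ p) Subset.⊥

∣ofList∣≤length : (xs : List (Fin n)) → ∣ ofList xs ∣ ≤ length xs
∣ofList∣≤length {n} []       = ℕ.≤-reflexive (∣⊥∣≡0 n)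
∣ofList∣≤length     (x ∷ xs) = ℕ.≤-trans (∣p∪q∣≤∣p∣+∣q∣ ⁅ x ⁆ (ofList xs))
  (ℕ.+-mono-≤ (ℕ.≤-reflexive (∣⁅x⁆∣≡1 x)) (∣ofList∣≤length xs))

∈-ofList : {x : Fin n} {xs : List (Fin n)} → x ∈ xs → x ∈ˢ ofList xs
∈-ofList (here refl) = x∈p∪q⁺ (inj₁ (x∈⁅x⁆ _))
∈-ofList (there x∈)  = x∈p∪q⁺ (inj₂ (∈-ofList x∈))

∃∈∖ : (p : Subset n) (xs : List (Fin n)) → length xs < ∣ p ∣ → ∃[ x ] x ∈ˢ p × x ∉ xs
∃∈∖ p xs xs<p with any? (λ x → (x ∈ˢ? p) ×-dec ¬? (x ∈? xs))
... | yes found = found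
... | no  none  = contradiction
  (ℕ.≤-trans (p⊆q⇒∣p∣≤∣q∣ {p = p} {q = ofList xs}
    λ {x} x∈p → ∈-ofList (decidable-stable (x ∈? xs) λ x∉ → none (x , x∈p , x∉))) (∣ofList∣≤length xs))
  (ℕ.<⇒≱ xs<p)

exhaust : {p : Subset n} (xs : List (Fin n)) → Unique xs → All (_∈ˢ p) xs →
          ∣ p ∣ ≡ length xs → ∀ {x} → x ∈ˢ p → x ∈ xs
exhaust {p = p} xs uniq xs∈p size {x} x∈p = decidable-stable (x ∈? xs) λ x∉ →
  ℕ.<-irrefl refl (subst (suc (length xs) ≤_) size
    (length≤∣p∣ (x ∷ xs) (All.¬Any⇒All¬ xs x∉ ∷ uniq) (x∈p ∷ xs∈p)))

Unique⇒length≤ : (xs : List (Fin n)) → Unique xs → length xs ≤ n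
Unique⇒length≤ xs uniq = ℕ.≤-trans (length≤∣p∣ xs uniq (All.tabulate λ _ → ∈⊤)) (∣p∣≤n ⊤)

∣tabulate∣ : (f : Fin n → Bool) →
             ∣ Vec.tabulate f ∣ ≡ sum (List.tabulate λ w → if f w then 1 else 0)
∣tabulate∣ {zero}  f = refl
∣tabulate∣ {suc n} f with f zero
... | true  = cong suc (∣tabulate∣ (f ∘ suc))
... | false = ∣tabulate∣ (f ∘ suc)

∉-∷ : {A : Set} {x y : A} {ys : List A} → x ≢ y → x ∉ ys → x ∉ y ∷ ys
∉-∷ x≢y x∉ (here x≡y) = x≢y x≡y
∉-∷ x≢y x∉ (there x∈) = x∉ x∈

∈∉⇒≢ : {A : Set} {x y : A} {xs : List A} → x ∈ xs → y ∉ xs → x ≢ y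
∈∉⇒≢ x∈ y∉ refl = y∉ x∈

-- Moves index `k` to the last place, so that statements about the first two of three indices apply
-- to any pair. `swap 2F` acts as the identity.
swap : Fin 3 → Permutation′ 3
swap k = transpose 2F k

injective₃ : {A : Set} (f : Fin 3 → A) → f 0F ≢ f 1F → f 0F ≢ f 2F → f 1F ≢ f 2F →
             ∀ k l → f k ≡ f l → k ≡ l
injective₃ f ≢₀₁ ≢₀₂ ≢₁₂ = λ where
  0F 0F _  → refl
  1F 1F _  → refl
  2F 2F _  → refl
  0F 1F eq → contradiction eq ≢₀₁
  0F 2F eq → contradiction eq ≢₀₂
  1F 2F eq → contradiction eq ≢₁₂
  1F 0F eq → contradiction (sym eq) ≢₀₁
  2F 0F eq → contradiction (sym eq) ≢₀₂
  2F 1F eq → contradiction (sym eq) ≢₁₂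

-- Neighbourhoods in a cubic graph

module CubicGraph (G : Graph) (cubic : Cubic G) where

  Vertex : Set
  Vertex = Fin (order G)

  infix 4 _~_
  _~_ : Vertex → Vertex → Set
  v ~ w = adj G v w ≡ true

  ~-sym : ∀ {v w} → v ~ w → w ~ v
  ~-sym {v} {w} = trans (adj-sym G w v)

  _~?_ : ∀ v w → Dec (v ~ w)
  v ~? w = adj G v w Bool.≟ true

  ~⇒≢ : ∀ {v w} → v ~ w → v ≢ w
  ~⇒≢ {v} v~v refl with () ← trans (sym v~v) (adj-irrefl G v)

  N : Vertex → Subset (order G)
  N v = Vec.tabulate (adj G v)

  ∣N∣≡3 : ∀ v → ∣ N v ∣ ≡ 3
  ∣N∣≡3 v = trans (∣tabulate∣ (adj G v))
    (trans (cong sum (sym (List.map-tabulate id λ w → if adj G v w then 1 else 0))) (cubic v))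

  ~⇒∈N : ∀ {v w} → v ~ w → w ∈ˢ N v
  ~⇒∈N {v} {w} v~w = Vec.lookup⇒[]= w _ (trans (Vec.lookup∘tabulate (adj G v) w) v~w)

  ∈N⇒~ : ∀ {v w} → w ∈ˢ N v → v ~ w
  ∈N⇒~ {v} {w} w∈N = trans (sym (Vec.lookup∘tabulate (adj G v) w)) (Vec.[]=⇒lookup w∈N)

  another : ∀ v xs → length xs < 3 → ∃[ w ] v ~ w × w ∉ xs
  another v xs xs<3 with w , w∈N , w∉ ← ∃∈∖ (N v) xs (subst (length xs <_) (sym (∣N∣≡3 v)) xs<3) =
    w , ∈N⇒~ w∈N , w∉

  data OneOf₃ (a b c w : Vertex) : Set where
    1st : w ≡ a → OneOf₃ a b c w
    2nd : w ≡ b → OneOf₃ a b c w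
    3rd : w ≡ c → OneOf₃ a b c w

  neighbours : ∀ {v a b c} → v ~ a → v ~ b → v ~ c → a ≢ b → a ≢ c → b ≢ c →
               ∀ {w} → v ~ w → OneOf₃ a b c w
  neighbours {v} v~a v~b v~c a≢b a≢c b≢c v~w
    with exhaust (_ ∷ _ ∷ _ ∷ []) ((a≢b ∷ a≢c ∷ []) ∷ (b≢c ∷ []) ∷ [] ∷ [])
           (~⇒∈N v~a ∷ ~⇒∈N v~b ∷ ~⇒∈N v~c ∷ []) (∣N∣≡3 v) (~⇒∈N v~w)
  ... | here w≡a                 = 1st w≡a
  ... | there (here w≡b)         = 2nd w≡b
  ... | there (there (here w≡c)) = 3rd w≡c

  third : ∀ {v a b} → v ~ a → v ~ b → a ≢ b →
          ∃[ c ] v ~ c × c ≢ a × c ≢ b × (∀ {w} → v ~ w → OneOf₃ a b c w)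
  third {v} {a} {b} v~a v~b a≢b
    with c , v~c , c∉ ← another v (a ∷ b ∷ []) (s≤s (s≤s (s≤s z≤n))) =
    c , v~c , c≢a , c≢b , neighbours v~a v~b v~c a≢b (c≢a ∘ sym) (c≢b ∘ sym)
    where
    c≢a : c ≢ a
    c≢a = c∉ ∘ here
    c≢b : c ≢ b
    c≢b = c∉ ∘ there ∘ here

  startUnique : ∀ {u a b} → u ~ a → u ~ b → a ≢ b → Unique (u ∷ a ∷ b ∷ [])
  startUnique u~a u~b a≢b = (~⇒≢ u~a ∷ ~⇒≢ u~b ∷ []) ∷ (a≢b ∷ []) ∷ [] ∷ []

  -- Sets closed under forcing, and the lower bound three

  module _ {Z : Subset (order G)} where

    -- A vertex of `S` with a neighbour outside `S` has a second one there, so no force leads out of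
    -- `S`: the complement of `S`, if nonempty, is a fort.
    stuck : (S : List Vertex) → (∀ {z} → z ∈ˢ Z → z ∈ S) →
            (∀ {s v} → s ∈ S → s ~ v → v ∉ S → ∃[ w ] s ~ w × w ≢ v × w ∉ S) →
            ∀ {v} → Black G Z v → v ∈ S
    stuck S Z⊆S noMove (initial v∈Z) = Z⊆S v∈Z
    stuck S Z⊆S noMove (force {u} {v} bu u~v others) = decidable-stable (v ∈? S) λ v∉S →
      let w , u~w , w≢v , w∉S = noMove (stuck S Z⊆S noMove bu) u~v v∉S
      in w∉S (stuck S Z⊆S noMove (others w u~w w≢v))

    Start : Set
    Start = ∃[ u ] ∃[ a ] ∃[ b ] u ∈ˢ Z × a ∈ˢ Z × b ∈ˢ Z × u ~ a × u ~ b × a ≢ b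

    -- A derivation carries no order of time. Descending through the premises of a force ends at one
    -- whose forcing vertex and two other neighbours are all initial, and this serves as the first
    -- force.
    ∈Z⊎start : ∀ {v} → Black G Z v → v ∈ˢ Z ⊎ Start
    ∈Z⊎start (initial v∈Z) = inj₁ v∈Z
    ∈Z⊎start (force {u} {v} bu u~v others)
      with a , u~a , a∉ ← another u (v ∷ []) (s≤s (s≤s z≤n))
      with b , u~b , b≢v , b≢a , _ ← third u~v u~a (a∉ ∘ here ∘ sym)
      with ∈Z⊎start bu | ∈Z⊎start (others a u~a (a∉ ∘ here)) | ∈Z⊎start (others b u~b b≢v)
    ... | inj₁ u∈Z | inj₁ a∈Z | inj₁ b∈Z = inj₂ (u , a , b , u∈Z , a∈Z , b∈Z , u~a , u~b , b≢a ∘ sym)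
    ... | inj₂ s   | _        | _        = inj₂ s
    ... | _        | inj₂ s   | _        = inj₂ s
    ... | _        | _        | inj₂ s   = inj₂ s

    -- If `v`, `a` and `b` all lie in `Z`, they form a start themselves, so one exists even when no
    -- force takes place.
    start : IsZeroForcingSet G Z → Vertex → Start
    start forces v
      with a , v~a , _ ← another v [] (s≤s z≤n)
      with b , v~b , b∉ ← another v (a ∷ []) (s≤s (s≤s z≤n))
      with ∈Z⊎start (forces v) | ∈Z⊎start (forces a) | ∈Z⊎start (forces b)
    ... | inj₁ v∈Z | inj₁ a∈Z | inj₁ b∈Z = v , a , b , v∈Z , a∈Z , b∈Z , v~a , v~b , b∉ ∘ here ∘ sym
    ... | inj₂ s   | _        | _        = s
    ... | _        | inj₂ s   | _        = s
    ... | _        | _        | inj₂ s   = s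

    3≤∣Z∣ : IsZeroForcingSet G Z → Vertex → 3 ≤ ∣ Z ∣
    3≤∣Z∣ forces v
      with u , a , b , u∈Z , a∈Z , b∈Z , u~a , u~b , a≢b ← start forces v =
      length≤∣p∣ (u ∷ a ∷ b ∷ []) (startUnique u~a u~b a≢b) (u∈Z ∷ a∈Z ∷ b∈Z ∷ [])

  -- B is the black set and h its three heads; the head with index k takes no part in the rung.
  data Tail (B : List Vertex) (h : Fin 3 → Vertex) : Set where
    apex : ∀ r → r ∉ B → (∀ k → h k ~ r) → (∀ v → v ∈ r ∷ B) → Tail B h
    rung : ∀ k a b → a ∉ B → b ∉ B →
           h (swap k ⟨$⟩ʳ 0F) ~ a → h (swap k ⟨$⟩ʳ 1F) ~ b → a ~ b →
           Tail (b ∷ a ∷ B) (a F.∷ b F.∷ F.tail (F.tail (h ∘ (swap k ⟨$⟩ʳ_)))) → Tail B h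

  -- The edges leaving a black set

  module _ (Z : Subset (order G)) (forces : IsZeroForcingSet G Z) where

    -- B is black and the edges leaving B are exactly h k — i k.
    record State {K} (B : List Vertex) (h i : Fin K → Vertex) : Set where
      field
        h∈B      : ∀ k → h k ∈ B
        i∉B      : ∀ k → i k ∉ B
        h~i      : ∀ k → h k ~ i k
        leaving  : ∀ {b w} → b ∈ B → b ~ w → w ∉ B → ∃[ k ] b ≡ h k × w ≡ i k
        -- Only the edges are distinct as pairs: heads may coincide, as at the beginning, and so may
        -- ends.
        distinct : ∀ k l → h k ≡ h l → i k ≡ i l → k ≡ l
        -- Puts `Z` inside `B` with the ends added, the set to which `stuck` is applied.
        Z⊆B∪i    : ∀ {z} → z ∈ˢ Z → z ∉ B → ∃[ k ] z ≡ i k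
        -- Bounds the length of `B` by the order of `G`, which makes the recursions below terminate.
        unique   : Unique B

      back : ∀ {k} → (∀ l → i k ≡ i l → k ≡ l) → ∀ {v} → i k ~ v → v ∈ B → v ≡ h k
      back {k} sep i~v v∈B with leaving v∈B (~-sym i~v) (i∉B k)
      ... | l , v≡h , ik≡il with refl ← sep l ik≡il = v≡h

    open State

    -- Lets `addRung` and `merge` be stated for the first two edges only.
    permute : ∀ {K B} {h i : Fin K → Vertex} (π : Permutation′ K) → State B h i →
              State B (h ∘ (π ⟨$⟩ʳ_)) (i ∘ (π ⟨$⟩ʳ_))
    permute {h = h} {i} π s = record
      { h∈B = h∈B s ∘ (π ⟨$⟩ʳ_)
      ; i∉B = i∉B s ∘ (π ⟨$⟩ʳ_)
      ; h~i = h~i s ∘ (π ⟨$⟩ʳ_)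
      ; leaving = λ b∈ b~w w∉ → let k , b≡ , w≡ = leaving s b∈ b~w w∉ in
          π ⟨$⟩ˡ k , trans b≡ (cong h (sym (inverseʳ π))) , trans w≡ (cong i (sym (inverseʳ π)))
      ; distinct = λ k l h≡ i≡ → trans (sym (inverseˡ π))
          (trans (cong (π ⟨$⟩ˡ_) (distinct s _ _ h≡ i≡)) (inverseˡ π))
      ; Z⊆B∪i = λ z∈ z∉ → let k , z≡ = Z⊆B∪i s z∈ z∉ in
          π ⟨$⟩ˡ k , trans z≡ (cong i (sym (inverseʳ π)))
      ; unique = unique s
      }

    -- Let `S` be `B` with all ends added. A vertex of `B` has no neighbour outside `S`, and each
    -- end has exactly two, since `h k` is its only neighbour in `S`. Hence `S` is closed under
    -- forcing, yet it is not everything.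
    stuckState : ∀ {K B} {h i : Fin (suc K) → Vertex} → State B h i →
                 (∀ k l → i k ≡ i l → k ≡ l) → (∀ k l → ¬ i k ~ i l) → ⊥
    stuckState {B = B} {h} {i} s i-inj i≁i =
      let w , w∉S , _ = fresh 0F (h 0F)
      in w∉S (stuck S Z⊆S noMove (forces w))
      where
      S = List.tabulate i ++ B

      ∉S : ∀ {w} → w ∉ S → w ∉ B × (∀ k → w ≢ i k)
      ∉S w∉ = w∉ ∘ ∈-++⁺ʳ (List.tabulate i) , λ where k refl → w∉ (∈-++⁺ˡ (∈-tabulate⁺ {f = i} k))

      -- Two neighbours of `i k` remain besides `h k`, and at least one of them is not `v`.
      fresh : ∀ k v → ∃[ w ] w ∉ S × w ≢ v × i k ~ w
      fresh k v
        with w , ik~w , w∉ ← another (i k) (h k ∷ v ∷ []) (s≤s (s≤s (s≤s z≤n))) =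
        w , (λ w∈S → [ (λ w∈i → let l , w≡il = ∈-tabulate⁻ {f = i} w∈i in
                               i≁i k l (subst (i k ~_) w≡il ik~w))
                     , (λ w∈B → w∉ (here (back s (i-inj k) ik~w w∈B))) ]′
                     (∈-++⁻ (List.tabulate i) w∈S))
          , w∉ ∘ there ∘ here , ik~w

      Z⊆S : ∀ {z} → z ∈ˢ Z → z ∈ S
      Z⊆S {z} z∈Z = decidable-stable (z ∈? S) λ z∉S →
        let z∉B , z≢i = ∉S z∉S ; k , z≡ = Z⊆B∪i s z∈Z z∉B in z≢i k z≡

      noMove : ∀ {v w} → v ∈ S → v ~ w → w ∉ S → ∃[ w′ ] v ~ w′ × w′ ≢ w × w′ ∉ S
      noMove {w = w} v∈S v~w w∉S with ∈-++⁻ (List.tabulate i) v∈S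
      ... | inj₁ v∈i with k , refl ← ∈-tabulate⁻ {f = i} v∈i =
        let w′ , w′∉S , w′≢w , v~w′ = fresh k w in w′ , v~w′ , w′≢w , w′∉S
      ... | inj₂ v∈B with w∉B , w≢i ← ∉S w∉S with k , _ , w≡i ← leaving s v∈B v~w w∉B =
        contradiction w≡i (w≢i k)

    -- Each of the two ends has one neighbour left besides its head and the other end. The edges to
    -- `j₀` and `j₁` replace the two absorbed ones, so the number of leaving edges is unchanged.
    addRung : ∀ {K B} {h i : Fin (suc (suc K)) → Vertex} → State B h i → i 0F ~ i 1F →
              (∀ l → i 0F ≡ i l → 0F ≡ l) → (∀ l → i 1F ≡ i l → 1F ≡ l) →
              ∃₂ λ j₀ j₁ → State (i 1F ∷ i 0F ∷ B)
                (i 0F F.∷ i 1F F.∷ F.tail (F.tail h)) (j₀ F.∷ j₁ F.∷ F.tail (F.tail i))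
    addRung {B = B} {h} {i} s i₀~i₁ sep₀ sep₁
      with j₀ , i₀~j₀ , j₀≢h₀ , j₀≢i₁ , N₀ ← third (~-sym (h~i s 0F)) i₀~i₁ (∈∉⇒≢ (h∈B s 0F) (i∉B s 1F))
         | j₁ , i₁~j₁ , j₁≢h₁ , j₁≢i₀ , N₁ ← third (~-sym (h~i s 1F)) (~-sym i₀~i₁) (∈∉⇒≢ (h∈B s 1F) (i∉B s 0F)) =
      j₀ , j₁ , record
      { h∈B = λ where
          0F → there (here refl)
          1F → here refl
          (suc (suc k)) → there (there (h∈B s _))
      ; i∉B = λ where
          0F → ∉-∷ j₀≢i₁ (∉-∷ (~⇒≢ i₀~j₀ ∘ sym) (j₀≢h₀ ∘ back s sep₀ i₀~j₀))
          1F → ∉-∷ (~⇒≢ i₁~j₁ ∘ sym) (∉-∷ j₁≢i₀ (j₁≢h₁ ∘ back s sep₁ i₁~j₁))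
          (suc (suc k)) → ∉-∷ (λ eq → contradiction (sep₁ _ (sym eq)) λ ())
                            (∉-∷ (λ eq → contradiction (sep₀ _ (sym eq)) λ ()) (i∉B s _))
      ; h~i = λ where
          0F → i₀~j₀
          1F → i₁~j₁
          (suc (suc k)) → h~i s _
      ; leaving = leaving′
      ; distinct = distinct′
      ; Z⊆B∪i = λ z∈Z z∉ → outside z∉ (Z⊆B∪i s z∈Z (z∉ ∘ there ∘ there))
      ; unique = All.¬Any⇒All¬ _ (∉-∷ (~⇒≢ i₀~i₁ ∘ sym) (i∉B s 1F))
               ∷ All.¬Any⇒All¬ _ (i∉B s 0F) ∷ unique s
      }
      where
      B′ = i 1F ∷ i 0F ∷ B
      h′ = i 0F F.∷ i 1F F.∷ F.tail (F.tail h)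
      i′ = j₀ F.∷ j₁ F.∷ F.tail (F.tail i)

      outside : ∀ {w} → w ∉ B′ → (∃[ k ] w ≡ i k) → ∃[ k ] w ≡ i′ k
      outside w∉ (0F , refl) = contradiction (there (here refl)) w∉
      outside w∉ (1F , refl) = contradiction (here refl) w∉
      outside w∉ (suc (suc k) , eq) = suc (suc k) , eq

      leaving′ : ∀ {b w} → b ∈ B′ → b ~ w → w ∉ B′ → ∃[ k ] b ≡ h′ k × w ≡ i′ k
      leaving′ (here refl) b~w w∉ with N₁ b~w
      ... | 1st refl = contradiction (there (there (h∈B s 1F))) w∉
      ... | 2nd refl = contradiction (there (here refl)) w∉
      ... | 3rd eq   = 1F , refl , eq
      leaving′ (there (here refl)) b~w w∉ with N₀ b~w
      ... | 1st refl = contradiction (there (there (h∈B s 0F))) w∉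
      ... | 2nd refl = contradiction (here refl) w∉
      ... | 3rd eq   = 0F , refl , eq
      leaving′ (there (there b∈B)) b~w w∉ with leaving s b∈B b~w (w∉ ∘ there ∘ there)
      ... | 0F , _ , refl = contradiction (there (here refl)) w∉
      ... | 1F , _ , refl = contradiction (here refl) w∉
      ... | suc (suc k) , eqs = suc (suc k) , eqs

      distinct′ : ∀ k l → h′ k ≡ h′ l → i′ k ≡ i′ l → k ≡ l
      distinct′ 0F 0F _ _ = refl
      distinct′ 0F 1F i₀≡i₁ _ = contradiction i₀≡i₁ (~⇒≢ i₀~i₁)
      distinct′ 1F 0F i₁≡i₀ _ = contradiction (sym i₁≡i₀) (~⇒≢ i₀~i₁)
      distinct′ 1F 1F _ _ = refl
      distinct′ 0F (suc (suc l)) eq _ = contradiction (sym eq) (∈∉⇒≢ (h∈B s _) (i∉B s _))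
      distinct′ 1F (suc (suc l)) eq _ = contradiction (sym eq) (∈∉⇒≢ (h∈B s _) (i∉B s _))
      distinct′ (suc (suc k)) 0F eq _ = contradiction eq (∈∉⇒≢ (h∈B s _) (i∉B s _))
      distinct′ (suc (suc k)) 1F eq _ = contradiction eq (∈∉⇒≢ (h∈B s _) (i∉B s _))
      distinct′ (suc (suc k)) (suc (suc l)) = distinct s _ _

    -- The common end spends two edges on its two heads and keeps a single one, to `j`; absorbing it
    -- lowers the number of leaving edges by one.
    merge : ∀ {K B} {h i : Fin (suc (suc K)) → Vertex} → State B h i → i 0F ≡ i 1F →
            (∀ l → i 0F ≢ i (suc (suc l))) →
            ∃[ j ] State (i 0F ∷ B) (i 0F F.∷ F.tail (F.tail h)) (j F.∷ F.tail (F.tail i))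
    merge {B = B} {h} {i} s i₀≡i₁ sep
      with j , i₀~j , j≢h₀ , j≢h₁ , N₀ ← third (~-sym (h~i s 0F))
             (~-sym (subst (h 1F ~_) (sym i₀≡i₁) (h~i s 1F)))
             (λ h₀≡h₁ → contradiction (distinct s 0F 1F h₀≡h₁ i₀≡i₁) λ ()) =
      j , record
      { h∈B = λ where
          0F → here refl
          (suc k) → there (h∈B s _)
      ; i∉B = λ where
          0F → ∉-∷ (~⇒≢ i₀~j ∘ sym) j∉B
          (suc k) → ∉-∷ (sep k ∘ sym) (i∉B s _)
      ; h~i = λ where
          0F → i₀~j
          (suc k) → h~i s _
      ; leaving = leaving′
      ; distinct = λ where
          0F 0F _ _ → refl
          0F (suc l) eq _ → contradiction (sym eq) (∈∉⇒≢ (h∈B s _) (i∉B s _))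
          (suc k) 0F eq _ → contradiction eq (∈∉⇒≢ (h∈B s _) (i∉B s _))
          (suc k) (suc l) h≡ i≡ → suc-injective (distinct s _ _ h≡ i≡)
      ; Z⊆B∪i = λ z∈Z z∉ → outside z∉ (Z⊆B∪i s z∈Z (z∉ ∘ there))
      ; unique = All.¬Any⇒All¬ _ (i∉B s 0F) ∷ unique s
      }
      where
      B′ = i 0F ∷ B
      h′ = i 0F F.∷ F.tail (F.tail h)
      i′ = j F.∷ F.tail (F.tail i)

      j∉B : j ∉ B
      j∉B j∈B with leaving s j∈B (~-sym i₀~j) (i∉B s 0F)
      ... | 0F , eq , _ = j≢h₀ eq
      ... | 1F , eq , _ = j≢h₁ eq
      ... | suc (suc k) , _ , eq = sep k eq

      outside : ∀ {w} → w ∉ B′ → (∃[ k ] w ≡ i k) → ∃[ k ] w ≡ i′ k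
      outside w∉ (0F , eq) = contradiction (here eq) w∉
      outside w∉ (1F , eq) = contradiction (here (trans eq (sym i₀≡i₁))) w∉
      outside w∉ (suc (suc k) , eq) = suc k , eq

      leaving′ : ∀ {b w} → b ∈ B′ → b ~ w → w ∉ B′ → ∃[ k ] b ≡ h′ k × w ≡ i′ k
      leaving′ (here refl) b~w w∉ with N₀ b~w
      ... | 1st refl = contradiction (there (h∈B s 0F)) w∉
      ... | 2nd refl = contradiction (there (h∈B s 1F)) w∉
      ... | 3rd eq   = 0F , refl , eq
      leaving′ (there b∈B) b~w w∉ with leaving s b∈B b~w (w∉ ∘ there)
      ... | 0F , _ , eq = contradiction (here eq) w∉
      ... | 1F , _ , eq = contradiction (here (trans eq (sym i₀≡i₁))) w∉
      ... | suc (suc k) , eqs = suc k , eqs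

    -- Which configurations of leaving edges let forcing finish

    dead₁ : ∀ {B} {h i : Fin 1 → Vertex} → ¬ State B h i
    dead₁ s = stuckState s (λ { 0F 0F _ → refl }) (λ { 0F 0F i~i → ~⇒≢ i~i refl })

    -- The recursions keep `order G < f + length B` for their fuel `f`; this refutes the case of
    -- fuel zero.
    noFuel : ∀ {K B} {h i : Fin K → Vertex} → State B h i → ¬ order G < length B
    noFuel s fuel = ℕ.<⇒≱ fuel (Unique⇒length≤ _ (unique s))

    burn : ∀ f {ℓ} → order G < suc f + ℓ → order G < f + suc (suc ℓ)
    burn f {ℓ} fuel = ℕ.≤-trans fuel (ℕ.≤-trans (ℕ.≤-reflexive (sym (ℕ.+-suc f ℓ))) (ℕ.+-monoʳ-≤ f (ℕ.n≤1+n _)))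

    -- Equal ends merge into a single leaving edge, distinct nonadjacent ends are stuck, and
    -- adjacent ends give a rung and again two edges on a larger `B`, which cannot go on forever.
    dead₂ : ∀ f {B} {h i : Fin 2 → Vertex} → State B h i → ¬ order G < f + length B
    dead₂ zero s = noFuel s
    dead₂ (suc f) {B} {i = i} s fuel with i 0F ≟ i 1F | i 0F ~? i 1F
    ... | yes i₀≡i₁ | _ = dead₁ (proj₂ (merge s i₀≡i₁ λ ()))
    ... | no  i₀≢i₁ | no i₀≁i₁ = stuckState s
      (λ { 0F 0F _ → refl ; 0F 1F eq → contradiction eq i₀≢i₁
         ; 1F 0F eq → contradiction (sym eq) i₀≢i₁ ; 1F 1F _ → refl })
      (λ { 0F 0F i~i → ~⇒≢ i~i refl ; 0F 1F → i₀≁i₁ ; 1F 0F → i₀≁i₁ ∘ ~-sym ; 1F 1F i~i → ~⇒≢ i~i refl })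
    ... | no  i₀≢i₁ | yes i₀~i₁ = dead₂ f (proj₂ (proj₂ (addRung s i₀~i₁
      (λ { 0F _ → refl ; 1F eq → contradiction eq i₀≢i₁ })
      (λ { 0F eq → contradiction (sym eq) i₀≢i₁ ; 1F _ → refl })))) (burn f fuel)

    -- Distinct edges with a common end have distinct heads, so these are all the neighbours of `r`.
    -- Thus `r ∷ B` is closed under adjacency and contains `Z`; as every vertex gets forced, it
    -- contains every vertex.
    apexTail : ∀ {B} {h i : Fin 3 → Vertex} → State B h i → i 0F ≡ i 1F → i 0F ≡ i 2F → Tail B h
    apexTail {B} {h} {i} s i₀≡i₁ i₀≡i₂ = apex r (i∉B s 0F) h~r
      λ v → stuck (r ∷ B) Z⊆S (λ v∈ v~w w∉ → contradiction (closed v∈ v~w) w∉) (forces v)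
      where
      r = i 0F

      r≡i : ∀ k → r ≡ i k
      r≡i 0F = refl
      r≡i 1F = i₀≡i₁
      r≡i 2F = i₀≡i₂

      h~r : ∀ k → h k ~ r
      h~r k = subst (h k ~_) (sym (r≡i k)) (h~i s k)

      h≢ : ∀ {k l} → k ≢ l → h k ≢ h l
      h≢ k≢l eq = k≢l (distinct s _ _ eq (trans (sym (r≡i _)) (r≡i _)))

      Z⊆S : ∀ {z} → z ∈ˢ Z → z ∈ r ∷ B
      Z⊆S {z} z∈Z = decidable-stable (z ∈? (r ∷ B)) λ z∉ →
        let k , z≡i = Z⊆B∪i s z∈Z (z∉ ∘ there) in z∉ (here (trans z≡i (sym (r≡i k))))

      closed : ∀ {v w} → v ∈ r ∷ B → v ~ w → w ∈ r ∷ B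
      closed (here refl) v~w
        with neighbours (~-sym (h~r 0F)) (~-sym (h~r 1F)) (~-sym (h~r 2F)) (h≢ λ ()) (h≢ λ ()) (h≢ λ ()) v~w
      ... | 1st refl = there (h∈B s 0F)
      ... | 2nd refl = there (h∈B s 1F)
      ... | 3rd refl = there (h∈B s 2F)
      closed {w = w} (there v∈B) v~w = decidable-stable (w ∈? (r ∷ B)) λ w∉ →
        let k , _ , w≡i = leaving s v∈B v~w (w∉ ∘ there) in w∉ (here (trans w≡i (sym (r≡i k))))

    -- Three equal ends give the apex, and exactly two equal ends lead to the dead case of two
    -- edges. Distinct ends need an adjacent pair, which becomes the next rung.
    tail : ∀ f {B} {h i : Fin 3 → Vertex} → State B h i → order G < f + length B → Tail B h
    tail zero s fuel = contradiction fuel (noFuel s)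
    tail (suc f) {B} {h} {i} s fuel = split
      where
      afterMerge : ∀ k → let π = swap k ⟨$⟩ʳ_ in i (π 0F) ≡ i (π 1F) → i (π 0F) ≢ i (π 2F) → Tail B h
      afterMerge k eq neq with s′ ← proj₂ (merge (permute (swap k) s) eq λ { 0F → neq }) =
        -- `dead₂` gets fuel of its own, `suc (order G)`, which suffices whatever the length of the
        -- list.
        contradiction (ℕ.≤-trans (ℕ.n<1+n (order G)) (ℕ.m≤m+n _ _)) (dead₂ (suc (order G)) s′)

      viaRung : (∀ k l → i k ≡ i l → k ≡ l) → ∀ k → let π = swap k ⟨$⟩ʳ_ in i (π 0F) ~ i (π 1F) → Tail B h
      viaRung i-inj k i₀~i₁ =
        rung k _ _ (i∉B s _) (i∉B s _) (h~i s _) (h~i s _) i₀~i₁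
          (tail f (proj₂ (proj₂ (addRung (permute (swap k) s) i₀~i₁ (sep 0F) (sep 1F)))) (burn f fuel))
        where
        sep : ∀ l l′ → i (swap k ⟨$⟩ʳ l) ≡ i (swap k ⟨$⟩ʳ l′) → l ≡ l′
        sep l l′ eq = trans (sym (inverseˡ (swap k)))
          (trans (cong (swap k ⟨$⟩ˡ_) (i-inj _ _ eq)) (inverseˡ (swap k)))

      split : Tail B h
      split with i 0F ≟ i 1F | i 0F ≟ i 2F | i 1F ≟ i 2F
      ... | yes i₀≡i₁ | yes i₀≡i₂ | _ = apexTail s i₀≡i₁ i₀≡i₂
      ... | yes i₀≡i₁ | no  i₀≢i₂ | _ = afterMerge 2F i₀≡i₁ i₀≢i₂
      ... | no  i₀≢i₁ | yes i₀≡i₂ | _ = afterMerge 1F i₀≡i₂ i₀≢i₁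
      -- `swap 0F` lists the remaining pair as 2, 1, hence the reversed equation.
      ... | no  i₀≢i₁ | no  i₀≢i₂ | yes i₁≡i₂ = afterMerge 0F (sym i₁≡i₂) (i₀≢i₂ ∘ sym)
      ... | no  i₀≢i₁ | no  i₀≢i₂ | no  i₁≢i₂
        with injective₃ i i₀≢i₁ i₀≢i₂ i₁≢i₂ | i 0F ~? i 1F | i 0F ~? i 2F | i 1F ~? i 2F
      ...   | i-inj | yes i₀~i₁ | _ | _ = viaRung i-inj 2F i₀~i₁
      ...   | i-inj | no _ | yes i₀~i₂ | _ = viaRung i-inj 1F i₀~i₂
      ...   | i-inj | no _ | no _ | yes i₁~i₂ = viaRung i-inj 0F (~-sym i₁~i₂)
      ...   | i-inj | no i₀≁i₁ | no i₀≁i₂ | no i₁≁i₂ = ⊥-elim (stuckState s i-inj λ where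
        0F 0F i~i → ~⇒≢ i~i refl
        1F 1F i~i → ~⇒≢ i~i refl
        2F 2F i~i → ~⇒≢ i~i refl
        0F 1F → i₀≁i₁
        0F 2F → i₀≁i₂
        1F 2F → i₁≁i₂
        1F 0F → i₀≁i₁ ∘ ~-sym
        2F 0F → i₀≁i₂ ∘ ~-sym
        2F 1F → i₁≁i₂ ∘ ~-sym)

    -- A start already exhausts a set of size three, so `Z` consists of `u` and two of its
    -- neighbours. The three edges at `u` then form a state.
    initialTail : ∣ Z ∣ ≡ 3 → Vertex → ∃[ u ] Tail (u ∷ []) (λ _ → u)
    initialTail ∣Z∣≡3 v
      with u , a , b , u∈Z , a∈Z , b∈Z , u~a , u~b , a≢b ← start forces v
      with c , u~c , c≢a , c≢b , N-u ← third u~a u~b a≢b =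
      u , tail (suc (order G)) {i = a F.∷ b F.∷ c F.∷ F.[]} (record
      { h∈B = λ _ → here refl
      ; i∉B = λ k → ∉-∷ (~⇒≢ (u~i k) ∘ sym) λ ()
      ; h~i = u~i
      ; leaving = λ { (here refl) u~w _ → leaving′ (N-u u~w) }
      ; distinct = λ _ _ _ → injective₃ _ a≢b (c≢a ∘ sym) (c≢b ∘ sym) _ _
      ; Z⊆B∪i = λ z∈Z z∉ → Z⊆ z∉
          (exhaust (u ∷ a ∷ b ∷ []) (startUnique u~a u~b a≢b) (u∈Z ∷ a∈Z ∷ b∈Z ∷ []) ∣Z∣≡3 z∈Z)
      ; unique = [] ∷ []
      }) (ℕ.m≤m+n (suc (order G)) 1)
      where
      i : Fin 3 → Vertex
      i = a F.∷ b F.∷ c F.∷ F.[]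

      u~i : ∀ k → u ~ i k
      u~i 0F = u~a
      u~i 1F = u~b
      u~i 2F = u~c

      leaving′ : ∀ {w} → OneOf₃ a b c w → ∃[ k ] u ≡ u × w ≡ i k
      leaving′ (1st eq) = 0F , refl , eq
      leaving′ (2nd eq) = 1F , refl , eq
      leaving′ (3rd eq) = 2F , refl , eq

      Z⊆ : ∀ {z} → z ∉ u ∷ [] → z ∈ u ∷ a ∷ b ∷ [] → ∃[ k ] z ≡ i k
      Z⊆ z∉ (here eq) = contradiction (here eq) z∉
      Z⊆ z∉ (there (here eq)) = 0F , eq
      Z⊆ z∉ (there (there (here eq))) = 1F , eq

  -- Cutting the rungs into blocks

  -- A ladder with rungs `x j`, `y j` that fills the gap from `B` to `B′`. The lists matter only
  -- through membership.
  record Rails (B B′ : List Vertex) {n} (x y : Fin (suc n) → Vertex) : Set where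
    field
      x~x   : ∀ j → x (inject₁ j) ~ x (suc j)
      y~y   : ∀ j → y (inject₁ j) ~ y (suc j)
      x~y   : ∀ j → x j ~ y j
      x-inj : ∀ j k → x j ≡ x k → j ≡ k
      y-inj : ∀ j k → y j ≡ y k → j ≡ k
      x≢y   : ∀ j k → x j ≢ y k
      x∉B   : ∀ j → x j ∉ B
      y∉B   : ∀ j → y j ∉ B
      B⊆B′  : ∀ {v} → v ∈ B → v ∈ B′
      x∈B′  : ∀ j → x j ∈ B′
      y∈B′  : ∀ j → y j ∈ B′
      cover : ∀ {v} → v ∈ B′ → v ∈ B ⊎ (∃[ j ] v ≡ x j) ⊎ (∃[ j ] v ≡ y j)

  open Rails

  -- Stated by membership so that the two new vertices can exchange roles although the list fixes
  -- their order.
  record Adds₂ (B : List Vertex) (a b : Vertex) (B′ : List Vertex) : Set where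
    field
      old   : ∀ {v} → v ∈ B → v ∈ B′
      a∈    : a ∈ B′
      b∈    : b ∈ B′
      split : ∀ {v} → v ∈ B′ → v ∈ B ⊎ v ≡ a ⊎ v ≡ b

  open Adds₂

  adds₂ : ∀ {B a b} → Adds₂ B a b (b ∷ a ∷ B)
  adds₂ = record
    { old = there ∘ there ; a∈ = there (here refl) ; b∈ = here refl
    ; split = λ where
        (here eq) → inj₂ (inj₂ eq)
        (there (here eq)) → inj₂ (inj₁ eq)
        (there (there v∈B)) → inj₁ v∈B }

  adds₂-comm : ∀ {B a b B′} → Adds₂ B a b B′ → Adds₂ B b a B′
  adds₂-comm A = record { old = old A ; a∈ = b∈ A ; b∈ = a∈ A ; split = Sum.map₂ Sum.swap ∘ split A }

  singleRung : ∀ {B a b B₁} → a ∉ B → b ∉ B → a ~ b → Adds₂ B a b B₁ → Rails B B₁ (a F.∷ F.[]) (b F.∷ F.[])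
  singleRung a∉B b∉B a~b A = record
    { x~x = λ () ; y~y = λ () ; x~y = λ { 0F → a~b }
    ; x-inj = λ { 0F 0F _ → refl } ; y-inj = λ { 0F 0F _ → refl }
    ; x≢y = λ { 0F 0F → ~⇒≢ a~b } ; x∉B = λ { 0F → a∉B } ; y∉B = λ { 0F → b∉B }
    ; B⊆B′ = old A ; x∈B′ = λ { 0F → a∈ A } ; y∈B′ = λ { 0F → b∈ A }
    ; cover = Sum.map₂ (Sum.map (0F ,_) (0F ,_)) ∘ split A }

  consRung : ∀ {B B₁ B′ n a b} {x y : Fin (suc n) → Vertex} → a ∉ B → b ∉ B → a ~ b → Adds₂ B a b B₁ →
             a ~ x 0F → b ~ y 0F → Rails B₁ B′ x y → Rails B B′ (a F.∷ x) (b F.∷ y)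
  consRung {B} {a = a} {b} {x} {y} a∉B b∉B a~b A a~x b~y R = record
    { x~x = λ { zero → a~x ; (suc j) → x~x R j }
    ; y~y = λ { zero → b~y ; (suc j) → y~y R j }
    ; x~y = λ { zero → a~b ; (suc j) → x~y R j }
    ; x-inj = λ where
        zero    zero    _  → refl
        zero    (suc k) eq → contradiction eq (a≢x k)
        (suc j) zero    eq → contradiction (sym eq) (a≢x j)
        (suc j) (suc k) eq → cong suc (x-inj R j k eq)
    ; y-inj = λ where
        zero    zero    _  → refl
        zero    (suc k) eq → contradiction eq (b≢y k)
        (suc j) zero    eq → contradiction (sym eq) (b≢y j)
        (suc j) (suc k) eq → cong suc (y-inj R j k eq)
    ; x≢y = λ where
        zero    zero    → ~⇒≢ a~b
        zero    (suc k) → ∈∉⇒≢ (a∈ A) (y∉B R k)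
        (suc j) zero    → ∈∉⇒≢ (b∈ A) (x∉B R j) ∘ sym
        (suc j) (suc k) → x≢y R j k
    ; x∉B = λ { zero → a∉B ; (suc j) → x∉B R j ∘ old A }
    ; y∉B = λ { zero → b∉B ; (suc j) → y∉B R j ∘ old A }
    ; B⊆B′ = B⊆B′ R ∘ old A
    ; x∈B′ = λ { zero → B⊆B′ R (a∈ A) ; (suc j) → x∈B′ R j }
    ; y∈B′ = λ { zero → B⊆B′ R (b∈ A) ; (suc j) → y∈B′ R j }
    ; cover = cover′ ∘ cover R }
    where
    a≢x : ∀ k → a ≢ x k
    a≢x k = ∈∉⇒≢ (a∈ A) (x∉B R k)

    b≢y : ∀ k → b ≢ y k
    b≢y k = ∈∉⇒≢ (b∈ A) (y∉B R k)

    cover′ : ∀ {v} → v ∈ _ ⊎ (∃[ j ] v ≡ x j) ⊎ (∃[ j ] v ≡ y j) →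
             v ∈ B ⊎ (∃[ j ] v ≡ (a F.∷ x) j) ⊎ (∃[ j ] v ≡ (b F.∷ y) j)
    cover′ (inj₂ (inj₁ (j , eq))) = inj₂ (inj₁ (suc j , eq))
    cover′ (inj₂ (inj₂ (j , eq))) = inj₂ (inj₂ (suc j , eq))
    cover′ (inj₁ v∈) with split A v∈
    ... | inj₁ v∈B       = inj₁ v∈B
    ... | inj₂ (inj₁ eq) = inj₂ (inj₁ (zero , eq))
    ... | inj₂ (inj₂ eq) = inj₂ (inj₂ (zero , eq))

  -- Tail B (a , b , c) cut into blocks; the first block starts with the rung a b, and c is the third head.
  data Blocks (B : List Vertex) : (a b c : Vertex) → Set where
    lastT  : ∀ {c B′ n} {p q : Fin (suc n) → Vertex} {r} → Rails B B′ p q → r ∉ B′ →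
             p (fromℕ n) ~ r → q (fromℕ n) ~ r → c ~ r → (∀ v → v ∈ r ∷ B′) →
             Blocks B (p 0F) (q 0F) c
    blockM : ∀ {c B′ B″ n} {x y : Fin (suc n) → Vertex} {z₁ z₂} → Rails B B′ x y →
             z₁ ∉ B′ → z₂ ∉ B′ → x (fromℕ n) ~ z₁ → c ~ z₂ → z₁ ~ z₂ → Adds₂ B′ z₁ z₂ B″ →
             -- `π` sends the index of an in-vertex of the next block to the index of the out-vertex
             -- joined to it.
             (π : Permutation′ 3) → let out = y (fromℕ n) F.∷ z₁ F.∷ z₂ F.∷ F.[] in ∀ {a b} →
             out (π ⟨$⟩ʳ 0F) ~ a → out (π ⟨$⟩ʳ 1F) ~ b → Blocks B″ a b (out (π ⟨$⟩ʳ 2F)) →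
             Blocks B (x 0F) (y 0F) c

  extend : ∀ {B B₁ a b a₁ b₁ c} → a ∉ B → b ∉ B → a ~ b → Adds₂ B a b B₁ → a ~ a₁ → b ~ b₁ →
           Blocks B₁ a₁ b₁ c → Blocks B a b c
  extend a∉ b∉ a~b A a~ b~ (lastT R r∉ p~r q~r c~r all) =
    lastT (consRung a∉ b∉ a~b A a~ b~ R) r∉ p~r q~r c~r all
  extend a∉ b∉ a~b A a~ b~ (blockM R z₁∉ z₂∉ x~z₁ c~z₂ z₁~z₂ A″ π ~a ~b bs) =
    blockM (consRung a∉ b∉ a~b A a~ b~ R) z₁∉ z₂∉ x~z₁ c~z₂ z₁~z₂ A″ π ~a ~b bs

  -- `M_n` is not symmetric in its rails: `z₁` hangs on the `x` side. Which rail that is becomes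
  -- known only where the run ends, so both orders are allowed.
  Parsed : List Vertex → (a b c : Vertex) → Set
  Parsed B a b c = Blocks B a b c ⊎ Blocks B b a c

  -- Builds a block `M_0`, which `extend` may lengthen later. `ρ` names the current heads as
  -- out-vertices of the block; the undetermined rail order of the next block is absorbed into `π`
  -- by a transposition.
  closeM : ∀ {B B₁ B₂ x y c z₁ z₂ a b} (h : Fin 3 → Vertex) → x ∉ B → y ∉ B → x ~ y → Adds₂ B x y B₁ →
           z₁ ∉ B₁ → z₂ ∉ B₁ → x ~ z₁ → c ~ z₂ → z₁ ~ z₂ → Adds₂ B₁ z₁ z₂ B₂ →
           (ρ : Permutation′ 3) → (∀ k → h k ≡ (y F.∷ z₁ F.∷ z₂ F.∷ F.[]) (ρ ⟨$⟩ʳ k)) → ∀ k →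
           h (swap k ⟨$⟩ʳ 0F) ~ a → h (swap k ⟨$⟩ʳ 1F) ~ b → Parsed B₂ a b (h (swap k ⟨$⟩ʳ 2F)) →
           Blocks B x y c
  closeM h x∉ y∉ x~y A z₁∉ z₂∉ x~z₁ c~z₂ z₁~z₂ A₂ ρ h≡ k h~a h~b = λ where
    (inj₁ bs) → blockM (singleRung x∉ y∉ x~y A) z₁∉ z₂∉ x~z₁ c~z₂ z₁~z₂ A₂ (swap k ∘ₚ ρ)
      (subst (_~ _) (h≡ _) h~a) (subst (_~ _) (h≡ _) h~b) (subst (Blocks _ _ _) (h≡ _) bs)
    (inj₂ bs) → blockM (singleRung x∉ y∉ x~y A) z₁∉ z₂∉ x~z₁ c~z₂ z₁~z₂ A₂ (transpose 0F 1F ∘ₚ swap k ∘ₚ ρ)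
      (subst (_~ _) (h≡ _) h~b) (subst (_~ _) (h≡ _) h~a) (subst (Blocks _ _ _) (h≡ _) bs)

  -- `h 0F`, `h 1F` is the rung just added. A next rung on the same pair prolongs the run. One on
  -- another pair requires a look one step further: it is reassigned if the apex follows, and closes
  -- a block otherwise.
  parse : ∀ {B} (h : Fin 3 → Vertex) → h 0F ∉ B → h 1F ∉ B → h 0F ~ h 1F → Tail (h 1F ∷ h 0F ∷ B) h →
          Parsed B (h 0F) (h 1F) (h 2F)
  parse h h₀∉ h₁∉ h₀~h₁ (apex r r∉ h~r all) =
    inj₁ (lastT (singleRung h₀∉ h₁∉ h₀~h₁ adds₂) r∉ (h~r 0F) (h~r 1F) (h~r 2F) all)
  parse h h₀∉ h₁∉ h₀~h₁ (rung 2F a b a∉ b∉ ~a ~b a~b t) =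
    Sum.map (extend h₀∉ h₁∉ h₀~h₁ adds₂ ~a ~b) (extend h₁∉ h₀∉ (~-sym h₀~h₁) (adds₂-comm adds₂) ~b ~a)
      (parse _ a∉ b∉ a~b t)
  -- The last rung a b and r span a triangle, so the rung a r can continue the run with apex b.
  parse h h₀∉ h₁∉ h₀~h₁ (rung 1F a b a∉ b∉ ~a ~b a~b (apex r r∉ h~r all)) =
    inj₁ (lastT (consRung h₀∉ h₁∉ h₀~h₁ adds₂ ~a (h~r 2F)
                  (singleRung a∉ (r∉ ∘ there ∘ there) (h~r 0F) adds₂))
      (∉-∷ (~⇒≢ (h~r 1F)) (∉-∷ (~⇒≢ a~b ∘ sym) b∉)) a~b (~-sym (h~r 1F)) ~b
      λ v → reorder (all v))
    where
    reorder : ∀ {v r b a : Vertex} {B} → v ∈ r ∷ b ∷ a ∷ B → v ∈ b ∷ r ∷ a ∷ B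
    reorder (here eq) = there (here eq)
    reorder (there (here eq)) = here eq
    reorder (there (there v∈)) = there (there v∈)
  -- The mirror image: now `b r` continues the run and `a` is the apex, with `h 1F` starting the
  -- first rail.
  parse h h₀∉ h₁∉ h₀~h₁ (rung 0F a b a∉ b∉ ~a ~b a~b (apex r r∉ h~r all)) =
    inj₂ (lastT (consRung h₁∉ h₀∉ (~-sym h₀~h₁) (adds₂-comm adds₂) ~b (h~r 2F)
                  (singleRung b∉ (r∉ ∘ there ∘ there) (h~r 1F) adds₂))
      (∉-∷ (~⇒≢ (h~r 0F)) (∉-∷ (~⇒≢ a~b) a∉)) (~-sym a~b) (~-sym (h~r 0F)) ~a
      λ v → reorder (all v))
    where
    reorder : ∀ {v r b a : Vertex} {B} → v ∈ r ∷ b ∷ a ∷ B → v ∈ a ∷ r ∷ b ∷ B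
    reorder (here eq) = there (here eq)
    reorder (there (here eq)) = there (there (here eq))
    reorder (there (there (here eq))) = here eq
    reorder (there (there (there v∈))) = there (there (there v∈))
  -- The run ends here. The rung `a b` becomes `z₁ z₂`, with `z₁ = a` next to `h 0F`, and the
  -- following rung starts a new block.
  parse h h₀∉ h₁∉ h₀~h₁ (rung 1F a b a∉ b∉ ~a ~b a~b (rung k a′ b′ a′∉ b′∉ ~a′ ~b′ a′~b′ t)) =
    inj₁ (closeM (a F.∷ b F.∷ F.tail (F.tail (h ∘ (swap 1F ⟨$⟩ʳ_)))) h₀∉ h₁∉ h₀~h₁ adds₂ a∉ b∉ ~a ~b a~b adds₂
      rotate (λ { 0F → refl ; 1F → refl ; 2F → refl }) k ~a′ ~b′ (parse _ a′∉ b′∉ a′~b′ t))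
    where
    rotate : Permutation′ 3
    -- The heads `a`, `b`, `h 1F` are the out-vertices `z₁`, `z₂`, `y`, with indices 1, 2, 0.
    rotate = transpose 0F 1F ∘ₚ transpose 0F 2F
  parse h h₀∉ h₁∉ h₀~h₁ (rung 0F a b a∉ b∉ ~a ~b a~b (rung k a′ b′ a′∉ b′∉ ~a′ ~b′ a′~b′ t)) =
    inj₂ (closeM (a F.∷ b F.∷ F.tail (F.tail (h ∘ (swap 0F ⟨$⟩ʳ_)))) h₁∉ h₀∉ (~-sym h₀~h₁) (adds₂-comm adds₂)
      b∉ a∉ ~b ~a (~-sym a~b) (adds₂-comm adds₂)
      -- The heads `a`, `b`, `h 0F` are now the out-vertices `z₂`, `z₁`, `y`, with indices 2, 1, 0.
      (transpose 0F 2F)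
      (λ { 0F → refl ; 1F → refl ; 2F → refl }) k ~a′ ~b′ (parse _ a′∉ b′∉ a′~b′ t))

-- Neighbours and forcing order in the family

module FamilyOrder (t : ℕ) (ns : Fin t → ℕ) (m : ℕ) (σ : Fin t → Permutation′ 3) where
  open Family t ns m σ

  -- Block first, then position along the block: the lexicographic order in which vertices turn
  -- black. The two ends of each rung, `z₁` and `z₂` included, share a rank.
  block level : V → ℕ
  block u       = 0
  block (x i _) = suc (toℕ i)
  block (y i _) = suc (toℕ i)
  block (z₁ i)  = suc (toℕ i)
  block (z₂ i)  = suc (toℕ i)
  block (p _)   = suc t
  block (q _)   = suc t
  block r       = suc t

  level u       = 0
  level (x _ j) = toℕ j
  level (y _ j) = toℕ j
  level (z₁ i)  = suc (ns i)
  level (z₂ i)  = suc (ns i)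
  level (p j)   = toℕ j
  level (q j)   = toℕ j
  level r       = suc m

  rank : V → ℕ × ℕ
  rank v = block v , level v

  infix 4 _⊏_
  _⊏_ : V → V → Set
  _⊏_ = ×-Lex _≡_ _<_ _<_ on rank

  ⊏-wellFounded : WellFounded _⊏_
  ⊏-wellFounded = On.wellFounded rank (×-wellFounded <-wellFounded <-wellFounded)

  ⊏-trans : ∀ {a b c} → a ⊏ b → b ⊏ c → a ⊏ c
  ⊏-trans {a} {b} {c} = ×-transitive {_<₁_ = _<_} {_<₂_ = _<_} isEquivalence (resp₂ _<_) ℕ.<-trans ℕ.<-trans
    {rank a} {rank b} {rank c}

  ⊏-irrefl : ∀ {a b} → a ⊏ b → rank a ≢ rank b
  ⊏-irrefl {a} {b} a⊏b eq =
    ×-irreflexive {_≈₁_ = _≡_} {_<₁_ = _<_} {_≈₂_ = _≡_} {_<₂_ = _<_} ℕ.<-irrefl ℕ.<-irrefl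
    {rank a} {rank b} (cong proj₁ eq , cong proj₂ eq) a⊏b

  ⊏-respʳ : ∀ {a b c} → rank b ≡ rank c → a ⊏ b → a ⊏ c
  ⊏-respʳ {a} eq = subst (×-Lex _≡_ _<_ _<_ (rank a)) eq

  ⊏-respˡ : ∀ {a b c} → rank a ≡ rank b → a ⊏ c → b ⊏ c
  ⊏-respˡ {c = c} eq = subst (λ ρ → ×-Lex _≡_ _<_ _<_ ρ (rank c)) eq

  ⊏⇒≢ : ∀ {a b} → a ⊏ b → a ≢ b
  ⊏⇒≢ a⊏b = ⊏-irrefl a⊏b ∘ cong rank

  -- The vertices with one neighbour of lower, one of equal and one of higher rank.
  data Inner : V → Set where
    x  : ∀ i j → Inner (x i j)
    y  : ∀ i j → Inner (y i j)
    z₁ : ∀ i → Inner (z₁ i)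
    z₂ : ∀ i → Inner (z₂ i)
    p  : ∀ j → Inner (p j)
    q  : ∀ j → Inner (q j)

  u⊏ : ∀ {v} → Inner v → u ⊏ v
  u⊏ (x i j) = inj₁ (s≤s z≤n)
  u⊏ (y i j) = inj₁ (s≤s z≤n)
  u⊏ (z₁ i)  = inj₁ (s≤s z≤n)
  u⊏ (z₂ i)  = inj₁ (s≤s z≤n)
  u⊏ (p j)   = inj₁ (s≤s z≤n)
  u⊏ (q j)   = inj₁ (s≤s z≤n)

  -- The in-vertices next to `u`, treated uniformly whether the first block is some `M` or already
  -- `T`.
  data First (k : Fin 3) : V → Set where
    inFirstM : ∀ i → toℕ i ≡ 0 → First k (inM i k)
    inOnlyT  : t ≡ 0 → First k (inT k)

  First⇒Arc : ∀ {k v} → First k v → Arc u v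
  First⇒Arc (inFirstM i i≡0) = uM i i≡0 _
  First⇒Arc (inOnlyT t≡0)    = uT t≡0 _

  First-unique : ∀ {k v w} → First k v → First k w → v ≡ w
  First-unique {k} (inFirstM i i≡0) (inFirstM j j≡0) =
    cong (λ i → inM i k) (toℕ-injective (trans i≡0 (sym j≡0)))
  First-unique (inFirstM i _) (inOnlyT t≡0) = contradiction (subst Fin t≡0 i) ¬Fin0
  First-unique (inOnlyT t≡0) (inFirstM i _) = contradiction (subst Fin t≡0 i) ¬Fin0
  First-unique (inOnlyT _) (inOnlyT _) = refl

  slot : V → Fin 3
  slot (y _ _) = 1F
  slot (q _)   = 1F
  slot (z₂ _)  = 2F
  slot r       = 2F
  -- The true index for `x` and `p`; a mere default for `u` and `z₁`, which are never in-vertices.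
  slot _       = 0F

  First⇒slot : ∀ {k v} → First k v → slot v ≡ k
  First⇒slot {0F} (inFirstM _ _) = refl
  First⇒slot {1F} (inFirstM _ _) = refl
  First⇒slot {2F} (inFirstM _ _) = refl
  First⇒slot {0F} (inOnlyT _)    = refl
  First⇒slot {1F} (inOnlyT _)    = refl
  First⇒slot {2F} (inOnlyT _)    = refl

  First-≢ : ∀ {k l v w} → k ≢ l → First k v → First l w → v ≢ w
  First-≢ k≢l v-first w-first refl = k≢l (trans (sym (First⇒slot v-first)) (First⇒slot w-first))

  outM-inner : ∀ i k → Inner (outM i k)
  outM-inner i 0F = y i _
  outM-inner i 1F = z₁ i
  outM-inner i 2F = z₂ i

  block-outM : ∀ i k → block (outM i k) ≡ suc (toℕ i)
  block-outM i 0F = refl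
  block-outM i 1F = refl
  block-outM i 2F = refl

  block-inM : ∀ i k → block (inM i k) ≡ suc (toℕ i)
  block-inM i 0F = refl
  block-inM i 1F = refl
  block-inM i 2F = refl

  block-inT : ∀ k → block (inT k) ≡ suc t
  block-inT 0F = refl
  block-inT 1F = refl
  block-inT 2F = refl

  Entered : V → Set
  Entered v = ∃[ b ] Inner b × Arc b v × block b < block v

  -- Outside the first block, the inverse of the bijection `σ` of the previous block finds the
  -- out-vertex joined to this in-vertex.
  enterM : ∀ i k → First k (inM i k) ⊎ Entered (inM i k)
  enterM i k with toℕ i in i≡
  ... | zero  = inj₁ (inFirstM i i≡)
  ... | suc l = inj₂ (outM i′ k′ , outM-inner i′ k′ , arc ,
      subst₂ _<_ (sym (block-outM i′ k′)) (sym (block-inM i k)) (s≤s (ℕ.≤-reflexive (sym i≡1+i′))))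
    where
    l<t : l < t
    l<t = ℕ.<-trans (ℕ.n<1+n l) (subst (_< t) i≡ (toℕ<n i))
    i′ = fromℕ< l<t
    k′ = σ i′ ⟨$⟩ˡ k
    i≡1+i′ : toℕ i ≡ suc (toℕ i′)
    i≡1+i′ = trans i≡ (cong suc (sym (toℕ-fromℕ< l<t)))
    arc : Arc (outM i′ k′) (inM i k)
    arc = subst (Arc (outM i′ k′) ∘ inM i) (inverseʳ (σ i′)) (chainM i′ i i≡1+i′ k′)

  enterT : ∀ k → First k (inT k) ⊎ Entered (inT k)
  -- A number equal to `t` is split instead of `t`, on which the types of `ns` and `σ` depend.
  enterT k with toℕ (fromℕ t) in t≡
  ... | zero  = inj₁ (inOnlyT (trans (sym (toℕ-fromℕ t)) t≡))
  ... | suc l = inj₂ (outM i k′ , outM-inner i k′ , arc ,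
      subst₂ _<_ (sym (block-outM i k′)) (sym (block-inT k)) (s≤s (ℕ.≤-reflexive 1+i≡t)))
    where
    1+l≡t : suc l ≡ t
    1+l≡t = trans (sym t≡) (toℕ-fromℕ t)
    l<t : l < t
    l<t = ℕ.≤-reflexive 1+l≡t
    i = fromℕ< l<t
    k′ = σ i ⟨$⟩ˡ k
    1+i≡t : suc (toℕ i) ≡ t
    1+i≡t = trans (cong suc (toℕ-fromℕ< l<t)) 1+l≡t
    arc : Arc (outM i k′) (inT k)
    arc = subst (Arc (outM i k′) ∘ inT) (inverseʳ (σ i)) (chainT i 1+i≡t k′)

  -- How `v` turns black: as `u`, as a neighbour of `u`, or forced by an inner vertex of lower rank.
  -- In-vertices of later blocks, `z₂` and `r` among them, are forced from the previous block.
  data Origin (v : V) : Set where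
    isU     : v ≡ u → Origin v
    isFirst : ∀ k → First k v → Origin v
    from    : ∀ {b} → Inner b → Arc b v → b ⊏ v → Origin v

  entered : ∀ {k v} → First k v ⊎ Entered v → Origin v
  entered (inj₁ v-first)             = isFirst _ v-first
  entered (inj₂ (b , ib , b→v , b<v)) = from ib b→v (inj₁ b<v)

  origin : ∀ v → Origin v
  origin u             = isU refl
  origin (x i zero)    = entered (enterM i 0F)
  origin (x i (suc j)) = from (x i _) (xx i j) (inj₂ (refl , s≤s (ℕ.≤-reflexive (toℕ-inject₁ j))))
  origin (y i zero)    = entered (enterM i 1F)
  origin (y i (suc j)) = from (y i _) (yy i j) (inj₂ (refl , s≤s (ℕ.≤-reflexive (toℕ-inject₁ j))))
  origin (z₁ i)        = from (x i _) (xz i) (inj₂ (refl , s≤s (ℕ.≤-reflexive (toℕ-fromℕ (ns i)))))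
  origin (z₂ i)        = entered (enterM i 2F)
  origin (p zero)      = entered (enterT 0F)
  origin (p (suc j))   = from (p _) (pp j) (inj₂ (refl , s≤s (ℕ.≤-reflexive (toℕ-inject₁ j))))
  origin (q zero)      = entered (enterT 1F)
  origin (q (suc j))   = from (q _) (qq j) (inj₂ (refl , s≤s (ℕ.≤-reflexive (toℕ-inject₁ j))))
  origin r             = entered (enterT 2F)

  back : ∀ {v} → Inner v → ∃[ b ] Arc b v × b ⊏ v
  back {v} iv with origin v
  ... | isU refl          = contradiction refl (⊏⇒≢ (u⊏ iv))
  ... | isFirst k v-first = u , First⇒Arc v-first , u⊏ iv
  ... | from _ b→v b⊏v    = _ , b→v , b⊏v

  side : ∀ {v} → Inner v → ∃[ s ] Adj v s × rank v ≡ rank s × v ≢ s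
  side (x i j) = y i j , inj₁ (xy i j) , refl , λ ()
  side (y i j) = x i j , inj₂ (xy i j) , refl , λ ()
  side (z₁ i)  = z₂ i , inj₁ (zz i) , refl , λ ()
  side (z₂ i)  = z₁ i , inj₂ (zz i) , refl , λ ()
  side (p j)   = q j , inj₁ (pq j) , refl , λ ()
  side (q j)   = p j , inj₂ (pq j) , refl , λ ()

  leave : ∀ i k → ∃[ w ] Arc (outM i k) w × outM i k ⊏ w
  leave i k with suc (toℕ i) <? t
  ... | yes 1+i<t = _ , chainM i j j≡1+i k ,
        inj₁ (subst₂ _<_ (sym (block-outM i k)) (sym (block-inM j _)) (s≤s (ℕ.≤-reflexive (sym j≡1+i))))
    where
    j = fromℕ< 1+i<t
    j≡1+i : toℕ j ≡ suc (toℕ i)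
    j≡1+i = toℕ-fromℕ< 1+i<t
  ... | no  1+i≮t = _ , chainT i (ℕ.≤-antisym (toℕ<n i) (ℕ.≮⇒≥ 1+i≮t)) k ,
        inj₁ (subst₂ _<_ (sym (block-outM i k)) (sym (block-inT _)) (s≤s (toℕ<n i)))

  forward : ∀ {v} → Inner v → ∃[ w ] Arc v w × v ⊏ w
  forward (x i j) with view j
  ... | ‵fromℕ     = _ , xz i , inj₂ (refl , s≤s (ℕ.≤-reflexive (toℕ-fromℕ (ns i))))
  ... | ‵inject₁ j = _ , xx i j , inj₂ (refl , s≤s (ℕ.≤-reflexive (toℕ-inject₁ j)))
  forward (y i j) with view j
  ... | ‵fromℕ     = leave i 0F
  ... | ‵inject₁ j = _ , yy i j , inj₂ (refl , s≤s (ℕ.≤-reflexive (toℕ-inject₁ j)))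
  forward (z₁ i) = leave i 1F
  forward (z₂ i) = leave i 2F
  forward (p j) with view j
  ... | ‵fromℕ     = _ , pr , inj₂ (refl , s≤s (ℕ.≤-reflexive (toℕ-fromℕ m)))
  ... | ‵inject₁ j = _ , pp j , inj₂ (refl , s≤s (ℕ.≤-reflexive (toℕ-inject₁ j)))
  forward (q j) with view j
  ... | ‵fromℕ     = _ , qr , inj₂ (refl , s≤s (ℕ.≤-reflexive (toℕ-fromℕ m)))
  ... | ‵inject₁ j = _ , qq j , inj₂ (refl , s≤s (ℕ.≤-reflexive (toℕ-inject₁ j)))

  record Neighbours (v : V) : Set where
    field
      {n₁ n₂ n₃} : V
      adj₁ : Adj v n₁
      adj₂ : Adj v n₂
      adj₃ : Adj v n₃
      n₁≢n₂ : n₁ ≢ n₂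
      n₁≢n₃ : n₁ ≢ n₃
      n₂≢n₃ : n₂ ≢ n₃

  -- n₁ is the neighbour that forceFirst lets v force.
  onward : ∀ {v w} → Inner v → Arc v w → v ⊏ w → Neighbours v
  onward iv v→w v⊏w
    with b , b→v , b⊏v ← back iv
       | s , v-s , v~s , _ ← side iv = record
    { adj₁ = inj₁ v→w ; adj₂ = inj₂ b→v ; adj₃ = v-s
    ; n₁≢n₂ = ⊏⇒≢ (⊏-trans b⊏v v⊏w) ∘ sym
    ; n₁≢n₃ = ⊏⇒≢ (⊏-respˡ v~s v⊏w) ∘ sym
    ; n₂≢n₃ = ⊏⇒≢ (⊏-respʳ v~s b⊏v) }

  module _ (in₀ : Fin 3 → V) (first : ∀ k → First k (in₀ k)) where

    fromU : Neighbours u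
    fromU = record
      -- The in-vertices 0 and 1 belong to the seed, so 2 is the one that `u` forces.
      { adj₁ = inj₁ (First⇒Arc (first 2F))
      ; adj₂ = inj₁ (First⇒Arc (first 0F)) ; adj₃ = inj₁ (First⇒Arc (first 1F))
      ; n₁≢n₂ = First-≢ (λ ()) (first 2F) (first 0F)
      ; n₁≢n₃ = First-≢ (λ ()) (first 2F) (first 1F)
      ; n₂≢n₃ = First-≢ (λ ()) (first 0F) (first 1F) }

    atR : Neighbours r
    atR = record
      { adj₁ = inj₂ pr ; adj₂ = inj₂ qr ; adj₃ = inj₂ (proj₁ (proj₂ entry))
      ; n₁≢n₂ = λ ()
      ; n₁≢n₃ = λ eq → ℕ.<⇒≢ (proj₂ (proj₂ entry)) (sym (cong block eq))
      ; n₂≢n₃ = λ eq → ℕ.<⇒≢ (proj₂ (proj₂ entry)) (sym (cong block eq)) }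
      where
      entry : ∃[ b ] Arc b r × block b < suc t
      entry with enterT 2F
      ... | inj₁ r-first             = u , First⇒Arc r-first , s≤s z≤n
      ... | inj₂ (b , _ , b→r , b<r) = b , b→r , b<r

    neighboursOf : ∀ v → Neighbours v
    neighboursOf u = fromU
    neighboursOf r = atR
    neighboursOf (x i j) = let _ , v→w , v⊏w = forward (x i j) in onward (x i j) v→w v⊏w
    neighboursOf (y i j) = let _ , v→w , v⊏w = forward (y i j) in onward (y i j) v→w v⊏w
    neighboursOf (z₁ i)  = let _ , v→w , v⊏w = forward (z₁ i) in onward (z₁ i) v→w v⊏w
    neighboursOf (z₂ i)  = let _ , v→w , v⊏w = forward (z₂ i) in onward (z₂ i) v→w v⊏w
    neighboursOf (p j)   = let _ , v→w , v⊏w = forward (p j) in onward (p j) v→w v⊏w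
    neighboursOf (q j)   = let _ , v→w , v⊏w = forward (q j) in onward (q j) v→w v⊏w

    module _ (G : Graph) (cubic : Cubic G) (g : V → Fin (order G)) (g-inj : ∀ {v w} → g v ≡ g w → v ≡ w)
             (g-adj : ∀ {v w} → Adj v w → CubicGraph._~_ G cubic (g v) (g w)) where
      open CubicGraph G cubic

      -- The images of three distinct neighbours of `v` already exhaust the neighbours of `g v` in a
      -- cubic graph, so an injective map preserving adjacency also reflects it.
      reflectAdj : ∀ {v w} → g v ~ g w → Adj v w
      reflectAdj {v} v~w
        with neighbours (g-adj adj₁) (g-adj adj₂) (g-adj adj₃) (n₁≢n₂ ∘ g-inj) (n₁≢n₃ ∘ g-inj) (n₂≢n₃ ∘ g-inj) v~w
        where open Neighbours (neighboursOf v)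
      ... | 1st eq = subst (Adj v) (sym (g-inj eq)) (Neighbours.adj₁ (neighboursOf v))
      ... | 2nd eq = subst (Adj v) (sym (g-inj eq)) (Neighbours.adj₂ (neighboursOf v))
      ... | 3rd eq = subst (Adj v) (sym (g-inj eq)) (Neighbours.adj₃ (neighboursOf v))

      seed : List Vertex
      seed = g u ∷ g (in₀ 0F) ∷ g (in₀ 1F) ∷ []

      Forced : V → Set
      Forced v = Black G (ofList seed) (g v)

      forceFirst : ∀ {v} (N : Neighbours v) → let open Neighbours N in
                   Forced v → Forced n₂ → Forced n₃ → Forced n₁
      forceFirst N bv b₂ b₃ = force bv (g-adj adj₁) λ w v~w w≢n₁ → others v~w w≢n₁
        where
        open Neighbours N
        others : ∀ {w} → _ ~ w → w ≢ g n₁ → Black G _ w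
        others v~w w≢n₁
          with neighbours (g-adj adj₁) (g-adj adj₂) (g-adj adj₃) (n₁≢n₂ ∘ g-inj) (n₁≢n₃ ∘ g-inj) (n₂≢n₃ ∘ g-inj) v~w
        ... | 1st eq   = contradiction eq w≢n₁
        ... | 2nd refl = b₂
        ... | 3rd refl = b₃

      seed-u : Forced u
      seed-u = initial (∈-ofList {xs = seed} (here refl))

      seed-0 : Forced (in₀ 0F)
      seed-0 = initial (∈-ofList {xs = seed} (there (here refl)))

      seed-1 : Forced (in₀ 1F)
      seed-1 = initial (∈-ofList {xs = seed} (there (there (here refl))))

      -- When `b` forces `v`, the remaining neighbours of `b` are one of lower rank and one of the
      -- same rank as `b`; all three precede `v`.
      forced : ∀ v → Acc _⊏_ v → Forced v
      forced v (acc rec) with origin v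
      ... | isU refl = seed-u
      ... | isFirst 0F v-first = subst Forced (First-unique (first 0F) v-first) seed-0
      ... | isFirst 1F v-first = subst Forced (First-unique (first 1F) v-first) seed-1
      ... | isFirst 2F v-first = subst Forced (First-unique (first 2F) v-first)
        (forceFirst fromU seed-u seed-0 seed-1)
      ... | from {b} ib b→v b⊏v = forceFirst (onward ib b→v b⊏v) (forced b (rec b⊏v))
        (forced _ (rec (⊏-trans (proj₂ (proj₂ (back ib))) b⊏v)))
        (forced _ (rec (⊏-respˡ (proj₁ (proj₂ (proj₂ (side ib)))) b⊏v)))

-- Embedding the family

firsts : ∀ t ns m σ → let open Family t ns m σ in
         Σ (Fin 3 → V) λ in₀ → ∀ k → FamilyOrder.First t ns m σ k (in₀ k)
firsts zero    ns m σ = Family.inT zero ns m σ , λ k → FamilyOrder.inOnlyT refl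
firsts (suc t) ns m σ = Family.inM (suc t) ns m σ zero , λ k → FamilyOrder.inFirstM zero refl

module _ (G : Graph) (cubic : Cubic G) where
  open CubicGraph G cubic

  -- The remaining blocks, placed outside `B`. Here `u` is a placeholder sent to `u₀`, and its arcs
  -- are left out of `f-arc` because the first block is so far attached to the heads; `first₀`,
  -- `first₁`, `first₂` record the attachment.
  record Embedding (u₀ : Vertex) (B : List Vertex) (a b c : Vertex)
                   (t : ℕ) (ns : Fin t → ℕ) (m : ℕ) (σ : Fin t → Permutation′ 3) : Set where
    open Family t ns m σ
    open FamilyOrder t ns m σ using (First)
    field
      f      : V → Vertex
      f-u    : f u ≡ u₀
      fresh  : ∀ v → v ≢ u → f v ∉ B
      f-inj  : ∀ v w → f v ≡ f w → v ≡ w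
      covers : ∀ w → w ∈ B ⊎ (∃[ v ] f v ≡ w)
      f-arc  : ∀ {v w} → Arc v w → v ≢ u → f v ~ f w
      first₀ : ∀ {v} → First 0F v → f v ≡ a
      first₁ : ∀ {v} → First 1F v → f v ≡ b
      first₂ : ∀ {v} → First 2F v → c ~ f v

  embedT : ∀ {u₀ B B′ c m} {P Q : Fin (suc m) → Vertex} {R} → u₀ ∈ B → Rails B B′ P Q → R ∉ B′ →
           P (fromℕ m) ~ R → Q (fromℕ m) ~ R → c ~ R → (∀ v → v ∈ R ∷ B′) →
           ∀ ns σ → Embedding u₀ B (P 0F) (Q 0F) c 0 ns m σ
  embedT {u₀} {B} {B′} {c} {m} {P} {Q} {R} u₀∈B rails R∉B′ P~R Q~R c~R all ns σ = record
    { f = f ; f-u = refl ; fresh = fresh ; f-inj = f-inj ; covers = covers ; f-arc = f-arc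
    ; first₀ = first₀ ; first₁ = first₁ ; first₂ = first₂ }
    where
    open Family 0 ns m σ
    open FamilyOrder 0 ns m σ using (First; inFirstM; inOnlyT)
    open Rails rails

    f : V → Vertex
    f u     = u₀
    f (p j) = P j
    f (q j) = Q j
    f r     = R

    fresh : ∀ v → v ≢ u → f v ∉ B
    fresh u     v≢u = contradiction refl v≢u
    fresh (p j) _   = x∉B j
    fresh (q j) _   = y∉B j
    fresh r     _   = R∉B′ ∘ B⊆B′

    f-inj : ∀ v w → f v ≡ f w → v ≡ w
    f-inj u     u     _  = refl
    f-inj u     (p j) eq = contradiction eq (∈∉⇒≢ u₀∈B (x∉B j))
    f-inj u     (q j) eq = contradiction eq (∈∉⇒≢ u₀∈B (y∉B j))
    f-inj u     r     eq = contradiction eq (∈∉⇒≢ (B⊆B′ u₀∈B) R∉B′)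
    f-inj (p j) u     eq = contradiction (sym eq) (∈∉⇒≢ u₀∈B (x∉B j))
    f-inj (p j) (p k) eq = cong p (x-inj j k eq)
    f-inj (p j) (q k) eq = contradiction eq (x≢y j k)
    f-inj (p j) r     eq = contradiction eq (∈∉⇒≢ (x∈B′ j) R∉B′)
    f-inj (q j) u     eq = contradiction (sym eq) (∈∉⇒≢ u₀∈B (y∉B j))
    f-inj (q j) (p k) eq = contradiction (sym eq) (x≢y k j)
    f-inj (q j) (q k) eq = cong q (y-inj j k eq)
    f-inj (q j) r     eq = contradiction eq (∈∉⇒≢ (y∈B′ j) R∉B′)
    f-inj r     u     eq = contradiction (sym eq) (∈∉⇒≢ (B⊆B′ u₀∈B) R∉B′)
    f-inj r     (p k) eq = contradiction (sym eq) (∈∉⇒≢ (x∈B′ k) R∉B′)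
    f-inj r     (q k) eq = contradiction (sym eq) (∈∉⇒≢ (y∈B′ k) R∉B′)
    f-inj r     r     _  = refl

    covers : ∀ w → w ∈ B ⊎ (∃[ v ] f v ≡ w)
    covers w with all w
    ... | here eq = inj₂ (r , sym eq)
    ... | there w∈B′ with cover w∈B′
    ...   | inj₁ w∈B             = inj₁ w∈B
    ...   | inj₂ (inj₁ (j , eq)) = inj₂ (p j , sym eq)
    ...   | inj₂ (inj₂ (j , eq)) = inj₂ (q j , sym eq)

    f-arc : ∀ {v w} → Arc v w → v ≢ u → f v ~ f w
    f-arc (pp j)   _   = x~x j
    f-arc (qq j)   _   = y~y j
    f-arc (pq j)   _   = x~y j
    f-arc pr       _   = P~R
    f-arc qr       _   = Q~R
    f-arc (uT _ _) v≢u = contradiction refl v≢u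

    first₀ : ∀ {v} → First 0F v → f v ≡ P 0F
    first₀ (inOnlyT _) = refl

    first₁ : ∀ {v} → First 1F v → f v ≡ Q 0F
    first₁ (inOnlyT _) = refl

    first₂ : ∀ {v} → First 2F v → c ~ f v
    first₂ (inOnlyT _) = c~R

  module _ {u₀ B B′ B″ c n} {X Y : Fin (suc n) → Vertex} {Z₁ Z₂ a b : Vertex} (u₀∈B : u₀ ∈ B)
           (rails : Rails B B′ X Y) (Z₁∉ : Z₁ ∉ B′) (Z₂∉ : Z₂ ∉ B′)
           (X~Z₁ : X (fromℕ n) ~ Z₁) (c~Z₂ : c ~ Z₂) (Z₁~Z₂ : Z₁ ~ Z₂) (adds : Adds₂ B′ Z₁ Z₂ B″)
           (π : Permutation′ 3) where

    out : Fin 3 → Vertex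
    out = Y (fromℕ n) F.∷ Z₁ F.∷ Z₂ F.∷ F.[]

    -- The new block is put in front and the other indices shift by one. `σ` runs from out-vertices
    -- to in-vertices and `π` the other way, hence `Perm.flip π`.
    embedM : out (π ⟨$⟩ʳ 0F) ~ a → out (π ⟨$⟩ʳ 1F) ~ b → ∀ {t ns m σ} →
             Embedding u₀ B″ a b (out (π ⟨$⟩ʳ 2F)) t ns m σ →
             Embedding u₀ B (X 0F) (Y 0F) c (suc t) (n F.∷ ns) m (Perm.flip π F.∷ σ)
    embedM out₀~a out₁~b {t} {ns} {m} {σ} E = record
      { f = f ; f-u = refl ; fresh = fresh ; f-inj = f-inj ; covers = covers ; f-arc = f-arc
      ; first₀ = first₀ ; first₁ = first₁ ; first₂ = first₂ }
      where
      module E = Embedding E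
      module Old = Family t ns m σ
      module OldOrder = FamilyOrder t ns m σ
      open Family (suc t) (n F.∷ ns) m (Perm.flip π F.∷ σ)
      open FamilyOrder (suc t) (n F.∷ ns) m (Perm.flip π F.∷ σ) using (First; inFirstM; inOnlyT)
      open Rails rails
      open Adds₂ adds using (a∈; b∈; split)

      ι : Old.V → V
      ι Old.u       = u
      ι (Old.x i j) = x (suc i) j
      ι (Old.y i j) = y (suc i) j
      ι (Old.z₁ i)  = z₁ (suc i)
      ι (Old.z₂ i)  = z₂ (suc i)
      ι (Old.p j)   = p j
      ι (Old.q j)   = q j
      ι Old.r       = r

      data New : V → Set where
        x  : ∀ j → New (x zero j)
        y  : ∀ j → New (y zero j)
        z₁ : New (z₁ zero)
        z₂ : New (z₂ zero)

      data View : V → Set where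
        new : ∀ {v} → New v → View v
        old : ∀ v → View (ι v)

      classify : ∀ v → View v
      classify u             = old Old.u
      classify (x zero j)    = new (x j)
      classify (x (suc i) j) = old (Old.x i j)
      classify (y zero j)    = new (y j)
      classify (y (suc i) j) = old (Old.y i j)
      classify (z₁ zero)     = new z₁
      classify (z₁ (suc i))  = old (Old.z₁ i)
      classify (z₂ zero)     = new z₂
      classify (z₂ (suc i))  = old (Old.z₂ i)
      classify (p j)         = old (Old.p j)
      classify (q j)         = old (Old.q j)
      classify r             = old Old.r

      f : V → Vertex
      f u             = u₀
      f (x zero j)    = X j
      f (x (suc i) j) = E.f (Old.x i j)
      f (y zero j)    = Y j
      f (y (suc i) j) = E.f (Old.y i j)
      f (z₁ zero)     = Z₁
      f (z₁ (suc i))  = E.f (Old.z₁ i)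
      f (z₂ zero)     = Z₂
      f (z₂ (suc i))  = E.f (Old.z₂ i)
      f (p j)         = E.f (Old.p j)
      f (q j)         = E.f (Old.q j)
      f r             = E.f Old.r

      f-ι : ∀ v → f (ι v) ≡ E.f v
      f-ι Old.u       = sym E.f-u
      f-ι (Old.x i j) = refl
      f-ι (Old.y i j) = refl
      f-ι (Old.z₁ i)  = refl
      f-ι (Old.z₂ i)  = refl
      f-ι (Old.p j)   = refl
      f-ι (Old.q j)   = refl
      f-ι Old.r       = refl

      f-inM : ∀ i k → f (inM (suc i) k) ≡ E.f (Old.inM i k)
      f-inM i 0F = refl
      f-inM i 1F = refl
      f-inM i 2F = refl

      f-inT : ∀ k → f (inT k) ≡ E.f (Old.inT k)
      f-inT 0F = refl
      f-inT 1F = refl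
      f-inT 2F = refl

      f-outM : ∀ i k → f (outM (suc i) k) ≡ E.f (Old.outM i k)
      f-outM i 0F = refl
      f-outM i 1F = refl
      f-outM i 2F = refl

      f-out₀ : ∀ k → f (outM zero k) ≡ out k
      f-out₀ 0F = refl
      f-out₀ 1F = refl
      f-out₀ 2F = refl

      outM≢u : ∀ i k → Old.outM i k ≢ Old.u
      outM≢u i 0F ()
      outM≢u i 1F ()
      outM≢u i 2F ()

      new∉B : ∀ {v} → New v → f v ∉ B
      new∉B (x j) = x∉B j
      new∉B (y j) = y∉B j
      new∉B z₁    = Z₁∉ ∘ B⊆B′
      new∉B z₂    = Z₂∉ ∘ B⊆B′

      new∈B″ : ∀ {v} → New v → f v ∈ B″
      new∈B″ (x j) = Adds₂.old adds (x∈B′ j)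
      new∈B″ (y j) = Adds₂.old adds (y∈B′ j)
      new∈B″ z₁    = a∈
      new∈B″ z₂    = b∈

      fresh : ∀ v → v ≢ u → f v ∉ B
      fresh v v≢u with classify v
      ... | new v-new = new∉B v-new
      ... | old v′    = E.fresh v′ (λ { refl → v≢u refl }) ∘ Adds₂.old adds ∘ B⊆B′ ∘ subst (_∈ B) (f-ι v′)

      new-inj : ∀ {v w} → New v → New w → f v ≡ f w → v ≡ w
      new-inj (x j) (x k) eq = cong (x zero) (x-inj j k eq)
      new-inj (x j) (y k) eq = contradiction eq (x≢y j k)
      new-inj (x j) z₁    eq = contradiction eq (∈∉⇒≢ (x∈B′ j) Z₁∉)
      new-inj (x j) z₂    eq = contradiction eq (∈∉⇒≢ (x∈B′ j) Z₂∉)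
      new-inj (y j) (x k) eq = contradiction (sym eq) (x≢y k j)
      new-inj (y j) (y k) eq = cong (y zero) (y-inj j k eq)
      new-inj (y j) z₁    eq = contradiction eq (∈∉⇒≢ (y∈B′ j) Z₁∉)
      new-inj (y j) z₂    eq = contradiction eq (∈∉⇒≢ (y∈B′ j) Z₂∉)
      new-inj z₁    (x k) eq = contradiction (sym eq) (∈∉⇒≢ (x∈B′ k) Z₁∉)
      new-inj z₁    (y k) eq = contradiction (sym eq) (∈∉⇒≢ (y∈B′ k) Z₁∉)
      new-inj z₁    z₁    eq = refl
      new-inj z₁    z₂    eq = contradiction eq (~⇒≢ Z₁~Z₂)
      new-inj z₂    (x k) eq = contradiction (sym eq) (∈∉⇒≢ (x∈B′ k) Z₂∉)
      new-inj z₂    (y k) eq = contradiction (sym eq) (∈∉⇒≢ (y∈B′ k) Z₂∉)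
      new-inj z₂    z₁    eq = contradiction (sym eq) (~⇒≢ Z₁~Z₂)
      new-inj z₂    z₂    eq = refl

      new≢old : ∀ {v} → New v → ∀ w → f v ≢ f (ι w)
      -- Only `u` needs `B`: its image `u₀` lies there, whereas every other old image avoids all of
      -- `B″`.
      new≢old v-new Old.u       eq = new∉B v-new (subst (_∈ B) (sym eq) u₀∈B)
      new≢old v-new (Old.x i j) = ∈∉⇒≢ (new∈B″ v-new) (E.fresh (Old.x i j) λ ())
      new≢old v-new (Old.y i j) = ∈∉⇒≢ (new∈B″ v-new) (E.fresh (Old.y i j) λ ())
      new≢old v-new (Old.z₁ i)  = ∈∉⇒≢ (new∈B″ v-new) (E.fresh (Old.z₁ i) λ ())
      new≢old v-new (Old.z₂ i)  = ∈∉⇒≢ (new∈B″ v-new) (E.fresh (Old.z₂ i) λ ())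
      new≢old v-new (Old.p j)   = ∈∉⇒≢ (new∈B″ v-new) (E.fresh (Old.p j) λ ())
      new≢old v-new (Old.q j)   = ∈∉⇒≢ (new∈B″ v-new) (E.fresh (Old.q j) λ ())
      new≢old v-new Old.r       = ∈∉⇒≢ (new∈B″ v-new) (E.fresh Old.r λ ())

      f-inj : ∀ v w → f v ≡ f w → v ≡ w
      f-inj v w eq with classify v | classify w
      ... | new v-new | new w-new = new-inj v-new w-new eq
      ... | new v-new | old w′    = contradiction eq (new≢old v-new w′)
      ... | old v′    | new w-new = contradiction (sym eq) (new≢old w-new v′)
      ... | old v′    | old w′    = cong ι (E.f-inj v′ w′ (trans (sym (f-ι v′)) (trans eq (f-ι w′))))

      covers : ∀ w → w ∈ B ⊎ (∃[ v ] f v ≡ w)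
      covers w with E.covers w
      ... | inj₂ (v , eq) = inj₂ (ι v , trans (f-ι v) eq)
      ... | inj₁ w∈B″ with split w∈B″
      ...   | inj₂ (inj₁ eq) = inj₂ (z₁ zero , sym eq)
      ...   | inj₂ (inj₂ eq) = inj₂ (z₂ zero , sym eq)
      ...   | inj₁ w∈B′ with cover w∈B′
      ...     | inj₁ w∈B             = inj₁ w∈B
      ...     | inj₂ (inj₁ (j , eq)) = inj₂ (x zero j , sym eq)
      ...     | inj₂ (inj₂ (j , eq)) = inj₂ (y zero j , sym eq)

      link : ∀ l {v} → OldOrder.First l v → out (π ⟨$⟩ʳ l) ~ E.f v
      link 0F v-first = subst (_ ~_) (sym (E.first₀ v-first)) out₀~a
      link 1F v-first = subst (_ ~_) (sym (E.first₁ v-first)) out₁~b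
      link 2F v-first = E.first₂ v-first

      linkOut : ∀ k {v} → OldOrder.First (π ⟨$⟩ˡ k) v → f (outM zero k) ~ E.f v
      linkOut k v-first = subst (_~ _) (trans (cong out (inverseʳ π)) (sym (f-out₀ k))) (link _ v-first)

      f-arc : ∀ {v w} → Arc v w → v ≢ u → f v ~ f w
      f-arc (xx zero j)    _   = x~x j
      f-arc (xx (suc i) j) _   = E.f-arc (Old.xx i j) λ ()
      f-arc (yy zero j)    _   = y~y j
      f-arc (yy (suc i) j) _   = E.f-arc (Old.yy i j) λ ()
      f-arc (xy zero j)    _   = x~y j
      f-arc (xy (suc i) j) _   = E.f-arc (Old.xy i j) λ ()
      f-arc (xz zero)      _   = X~Z₁
      f-arc (xz (suc i))   _   = E.f-arc (Old.xz i) λ ()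
      f-arc (zz zero)      _   = Z₁~Z₂
      f-arc (zz (suc i))   _   = E.f-arc (Old.zz i) λ ()
      f-arc (pp j)         _   = E.f-arc (Old.pp j) λ ()
      f-arc (qq j)         _   = E.f-arc (Old.qq j) λ ()
      f-arc (pq j)         _   = E.f-arc (Old.pq j) λ ()
      f-arc pr             _   = E.f-arc Old.pr λ ()
      f-arc qr             _   = E.f-arc Old.qr λ ()
      f-arc (uM _ _ _)     v≢u = contradiction refl v≢u
      f-arc (uT () _)
      -- Here block `suc j` directly follows the new one, so `j` is the first block of the old
      -- family and `link` applies.
      f-arc (chainM zero (suc j) eq k) _ =
        subst (f (outM zero k) ~_) (sym (f-inM j _)) (linkOut k (OldOrder.inFirstM j (ℕ.suc-injective eq)))
      f-arc (chainM (suc i) (suc j) eq k) _ =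
        subst₂ _~_ (sym (f-outM i k)) (sym (f-inM j _))
          (E.f-arc (Old.chainM i j (ℕ.suc-injective eq) k) (outM≢u i k))
      f-arc (chainT zero eq k) _ =
        subst (f (outM zero k) ~_) (sym (f-inT _)) (linkOut k (OldOrder.inOnlyT (ℕ.suc-injective (sym eq))))
      f-arc (chainT (suc i) eq k) _ =
        subst₂ _~_ (sym (f-outM i k)) (sym (f-inT _))
          (E.f-arc (Old.chainT i (ℕ.suc-injective eq) k) (outM≢u i k))

      first₀ : ∀ {v} → First 0F v → f v ≡ X 0F
      first₀ (inFirstM zero _) = refl

      first₁ : ∀ {v} → First 1F v → f v ≡ Y 0F
      first₁ (inFirstM zero _) = refl

      first₂ : ∀ {v} → First 2F v → c ~ f v
      first₂ (inFirstM zero _) = c~Z₂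

  embed : ∀ {u₀ B a b c} → u₀ ∈ B → Blocks B a b c →
          ∃[ t ] ∃[ ns ] ∃[ m ] ∃[ σ ] Embedding u₀ B a b c t ns m σ
  embed u₀∈B (lastT R r∉ p~r q~r c~r all) =
    _ , (λ ()) , _ , (λ ()) , embedT u₀∈B R r∉ p~r q~r c~r all (λ ()) (λ ())
  embed u₀∈B (blockM R z₁∉ z₂∉ x~z₁ c~z₂ z₁~z₂ adds π ~a ~b bs)
    with _ , _ , _ , _ , E ← embed (Adds₂.old adds (Rails.B⊆B′ R u₀∈B)) bs =
    _ , _ , _ , _ , embedM u₀∈B R z₁∉ z₂∉ x~z₁ c~z₂ z₁~z₂ adds π ~a ~b E

  -- From embeddings to isomorphisms, and the two directions of the equivalence

  embedding⇒iso : ∀ {u₀ a b t ns m σ} → u₀ ~ a → u₀ ~ b →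
                  Embedding u₀ (u₀ ∷ []) a b u₀ t ns m σ → IsoFamily G t ns m σ
  embedding⇒iso {u₀} {a} {b} {t} {ns} {m} {σ} u₀~a u₀~b E =
    mk↔ₛ′ to f (λ v → f-inj _ _ (f-to (f v))) f-to ,
    λ i j → mk⇔
      (λ i~j → reflectAdj in₀ first G cubic f (f-inj _ _) f-adj
        (subst₂ _~_ (sym (f-to i)) (sym (f-to j)) i~j))
      (λ adj → subst₂ _~_ (f-to i) (f-to j) (f-adj adj))
    where
    open Embedding E
    open Family t ns m σ
    open FamilyOrder t ns m σ

    in₀ = proj₁ (firsts t ns m σ)
    first = proj₂ (firsts t ns m σ)

    -- The only vertex of the list `u₀ ∷ []` is the image of `u`, so `covers` gives surjectivity.
    surjective : ∀ w → ∃[ v ] f v ≡ w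
    surjective w with covers w
    ... | inj₁ (here w≡u₀) = u , trans f-u (sym w≡u₀)
    ... | inj₂ found       = found

    to : Vertex → V
    to w = proj₁ (surjective w)

    f-to : ∀ w → f (to w) ≡ w
    f-to w = proj₂ (surjective w)

    f-first : ∀ {k v} → First k v → f u ~ f v
    f-first {0F} v-first = subst₂ _~_ (sym f-u) (sym (first₀ v-first)) u₀~a
    f-first {1F} v-first = subst₂ _~_ (sym f-u) (sym (first₁ v-first)) u₀~b
    f-first {2F} v-first = subst (_~ _) (sym f-u) (first₂ v-first)

    arc⇒~ : ∀ {v w} → Arc v w → f v ~ f w
    arc⇒~ (uM i i≡0 k) = f-first (inFirstM i i≡0)
    arc⇒~ (uT t≡0 k)   = f-first (inOnlyT t≡0)
    arc⇒~ a@(xx _ _)         = f-arc a λ ()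
    arc⇒~ a@(yy _ _)         = f-arc a λ ()
    arc⇒~ a@(xy _ _)         = f-arc a λ ()
    arc⇒~ a@(xz _)           = f-arc a λ ()
    arc⇒~ a@(zz _)           = f-arc a λ ()
    arc⇒~ a@(pp _)           = f-arc a λ ()
    arc⇒~ a@(qq _)           = f-arc a λ ()
    arc⇒~ a@(pq _)           = f-arc a λ ()
    arc⇒~ a@pr               = f-arc a λ ()
    arc⇒~ a@qr               = f-arc a λ ()
    arc⇒~ a@(chainM i _ _ k) = f-arc a (⊏⇒≢ (u⊏ (outM-inner i k)) ∘ sym)
    arc⇒~ a@(chainT i _ k)   = f-arc a (⊏⇒≢ (u⊏ (outM-inner i k)) ∘ sym)

    f-adj : ∀ {v w} → Adj v w → f v ~ f w
    f-adj (inj₁ v→w) = arc⇒~ v→w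
    f-adj (inj₂ w→v) = ~-sym (arc⇒~ w→v)

  InFamily : Set
  InFamily = (Σ ℕ λ m → IsoK1T G m)
             ⊎ (Σ ℕ λ t → t ≥ 1 × Σ (Fin t → ℕ) λ ns → Σ ℕ λ m →
                  Σ (Fin t → Permutation′ 3) λ σ → IsoFamily G t ns m σ)

  -- The kind of the first block decides between the two alternatives, `t = 0` and `t ≥ 1`.
  blocks⇒inFamily : ∀ {u₀ a b} → u₀ ~ a → u₀ ~ b → Blocks (u₀ ∷ []) a b u₀ → InFamily
  blocks⇒inFamily u₀~a u₀~b (lastT R r∉ p~r q~r c~r all) =
    -- `embedT` is used directly, as it accepts the particular empty functions fixed by `IsoK1T`.
    inj₁ (_ , embedding⇒iso u₀~a u₀~b (embedT (here refl) R r∉ p~r q~r c~r all _ _))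
  blocks⇒inFamily u₀~a u₀~b (blockM R z₁∉ z₂∉ x~z₁ c~z₂ z₁~z₂ adds π ~a ~b bs)
    with _ , _ , _ , _ , E ← embed (Adds₂.old adds (Rails.B⊆B′ R (here refl))) bs =
    inj₂ (_ , s≤s z≤n , _ , _ , _ , embedding⇒iso u₀~a u₀~b
      (embedM (here refl) R z₁∉ z₂∉ x~z₁ c~z₂ z₁~z₂ adds π ~a ~b E))

  iso⇒Z≡3 : ∀ {t ns m σ} → IsoFamily G t ns m σ → ZeroForcingNumber G 3
  iso⇒Z≡3 {t} {ns} {m} {σ} (iso , adj⇔) =
    -- The seed list bounds the size from above by its length, and the general lower bound gives
    -- equality.
    (ofList S , forces , ℕ.≤-antisym (∣ofList∣≤length S) (3≤∣Z∣ forces (g u))) ,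
    λ Z Z-forces → 3≤∣Z∣ Z-forces (g u)
    where
    open Family t ns m σ
    open FamilyOrder t ns m σ

    in₀ = proj₁ (firsts t ns m σ)
    first = proj₂ (firsts t ns m σ)

    g : V → Vertex
    g = Inverse.from iso

    to-g : ∀ v → Inverse.to iso (g v) ≡ v
    to-g v = Inverse.strictlyInverseˡ iso v

    g-inj : ∀ {v w} → g v ≡ g w → v ≡ w
    g-inj eq = trans (sym (to-g _)) (trans (cong (Inverse.to iso) eq) (to-g _))

    g-adj : ∀ {v w} → Adj v w → g v ~ g w
    g-adj adj = Equivalence.from (adj⇔ _ _) (subst₂ Adj (sym (to-g _)) (sym (to-g _)) adj)

    S : List Vertex
    S = seed in₀ first G cubic g g-inj g-adj

    forces : IsZeroForcingSet G (ofList S)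
    forces w = subst (Black G (ofList S)) (Inverse.strictlyInverseʳ iso w)
      (forced in₀ first G cubic g g-inj g-adj (Inverse.to iso w) (⊏-wellFounded _))

  tail⇒inFamily : ∀ {u} → Tail (u ∷ []) (λ _ → u) → InFamily
  tail⇒inFamily {u} (rung k a b a∉ b∉ u~a u~b a~b t) =
    [ blocks⇒inFamily u~a u~b , blocks⇒inFamily u~b u~a ]′
      (parse (a F.∷ b F.∷ F.tail (F.tail λ _ → u)) a∉ b∉ a~b t)
  -- An immediate apex would leave only the vertices `u` and `r`, but `u` has a neighbour other than
  -- `r`.
  tail⇒inFamily {u} (apex r _ _ all) with another u (r ∷ []) (s≤s (s≤s z≤n))
  ... | w , u~w , w∉ with all w
  ...   | here w≡r         = contradiction (here w≡r) w∉
  ...   | there (here w≡u) = contradiction (sym w≡u) (~⇒≢ u~w)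

  Z≡3⇒inFamily : ZeroForcingNumber G 3 → InFamily
  Z≡3⇒inFamily ((Z , forces , ∣Z∣≡3) , _) =
    let v , _ = ∃∈∖ Z [] (subst (0 <_) (sym ∣Z∣≡3) (s≤s z≤n))
    in tail⇒inFamily (proj₂ (initialTail Z forces ∣Z∣≡3 v))

theorem5 : (G : Graph) → Cubic G →
    ZeroForcingNumber G 3 ⇔
    ((Σ ℕ λ m → IsoK1T G m)
    ⊎ (Σ ℕ λ t → t ≥ 1 × Σ (Fin t → ℕ) λ ns → Σ ℕ λ m →
    Σ (Fin t → Permutation′ 3) λ σ → IsoFamily G t ns m σ))
theorem5 G cubic = mk⇔ (Z≡3⇒inFamily G cubic) λ where
  (inj₁ (_ , iso))                 → iso⇒Z≡3 G cubic iso
  (inj₂ (_ , _ , _ , _ , _ , iso)) → iso⇒Z≡3 G cubic iso
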